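{- Let $I$ be a finite nonempty set of items, let $s(i)$ be a positive integer size for each $i\in I$, and let $f\colon 2^I\to\mathbb{R}_+$ be monotone and submodular with $f(\emptyset)=0$. Let $\Pi^1$ and $\Pi^2$ be the item sequences described in the context, and consider the randomized universal policy (with cancellation, unknown capacity) that uses $\Pi^1$ with probability $1/2$ and $\Pi^2$ with probability $1/2$. This randomized universal policy is $\frac{1}{2}\left(1-\frac{1}{\sqrt[4]{e}}\right)$-robust (where $\frac{1}{2}(1-1/\sqrt[4]{e})>0.110$); that is, for every capacity $C\in\mathbb{R}_+$, $$\frac{f(\Pi^1(C))+f(\Pi^2(C))}{2}\ \ge\ \frac12\left(1-\frac{1}{\sqrt[4]{e}}\right) f(\mathrm{OPT}_C).$$
   Context: Notation: $s(X)=\sum_{i\in X}s(i)$; $\mathrm{OPT}_C$ is a set maximizing $f(X)$ over $X\subseteq I$ with $s(X)\le C$. Universal policy with cancellation: a universal policy is a sequence $\Pi=(\Pi_1,\dots,\Pi_n)$ of the $n$ items of $I$. For capacity $C$, its output $\Pi(C)$ is built by starting with the empty set and, for $k=1,\dots,n$, adding $\Pi_k$ if the total size of the current set plus $s(\Pi_k)$ is at most $C$, and discarding $\Pi_k$ (and continuing) otherwise. A randomized universal policy is a probability distribution over such sequences; it is $\alpha$-robust if for every $C\in\mathbb{R}_+$ the expected value of $f$ on its output is at least $\alpha f(\mathrm{OPT}_C)$. Greedy procedure $\mathcal{P}^1$ with capacity $c$: start with $X=\emptyset$, $R=I$. For $j=1,\dots,|I|$: choose $i_j\in\arg\max\{(f(X\cup\{i\})-f(X))/s(i)\colon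 i\in R\}$ (ties arbitrary); if $s(X)+s(i_j)\le c$ set $X\leftarrow X\cup\{i_j\}$; in any case set $R\leftarrow R\setminus\{i_j\}$. The output is denoted $\mathcal{P}^1(c)$. Sequence $\Pi^1$: let $s_{\min}=\min_{i\in I}s(i)$. For $k=0,1,\dots,\lceil\log_2(\sum_{i\in I}s(i)/s_{\min})\rceil$ in this order, let $Y^{(k)}=\mathcal{P}^1(2^k s_{\min})$ and append to the sequence the items of $Y^{(k)}\setminus\bigcup_{j=0}^{k-1}Y^{(j)}$ in arbitrary order. Sequence $\Pi^2$: the items of $I$ in decreasing order of $f(\{i\})$ (ties arbitrary). -}

module Defs where

open import Data.Bool.Base using (if_then_else_)
open import Data.Empty using (⊥-elim)
open import Data.Fin.Base using (Fin)
open import Data.Fin.Subset as Subset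
  using (Subset; _∈_; _⊆_; _∪_; _∩_; _─_; ⁅_⁆; ⋃; ⊤; ⊥; Empty)
import Data.Integer.Base as ℤ
import Data.Integer.Properties as ℤ
open import Data.List.Base using (List; []; _∷_; concat; applyUpTo)
import Data.List.Membership.Propositional as List
open import Data.List.Relation.Unary.AllPairs using (AllPairs)
open import Data.List.Relation.Unary.Unique.Propositional using (Unique)
open import Data.Nat.Base as ℕ using (ℕ; zero; suc; NonZero; _!)
import Data.Nat.Properties as ℕ
open import Data.Product using (∃-syntax; _×_; _,_)
open import Data.Rational.Base as ℚ using (ℚ; mkℚ; 0ℚ; 1ℚ; ½)
import Data.Rational.Properties as ℚ
import Data.Rational.Unnormalised.Base as ℚᵘ
import Data.Rational.Unnormalised.Properties as ℚᵘ
open import Data.Sum.Base using (inj₁; inj₂)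
import Data.Vec.Base as Vec
open import Function.Base using (_∘_)
open import Function.Bundles using (_⇔_)
open import Relation.Binary.PropositionalEquality
open import Relation.Nullary using (¬_; yes; no)
open import Relation.Nullary.Decidable using (map′)
open import Relation.Unary using (Decidable)

------------------------------------------------------------------------
-- Rational arithmetic

module RationalLemmas where

  open import Data.Rational.Base using (_+_; _*_; _-_; -_; _≤_; _<_; _⊔_; ∣_∣; _/_; 1/_)
  open import Data.Rational.Solver using (module +-*-Solver)
  open +-*-Solver using (solve; _:=_; _:+_; _:*_; _:-_; :-_; con)
  open ℚ.≤-Reasoning

  ≤-by : ∀ {p q r} → p ≡ q → q ≤ r → p ≤ r
  ≤-by refl q≤r = q≤r

  *-mono-≤ : ∀ {a b c d} → 0ℚ ≤ a → a ≤ b → 0ℚ ≤ c → c ≤ d → a * c ≤ b * d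
  *-mono-≤ {a} {b} {c} {d} 0≤a a≤b 0≤c c≤d = ℚ.≤-trans
    (ℚ.*-monoʳ-≤-nonNeg c {{ℚ.nonNegative 0≤c}} a≤b)
    (ℚ.*-monoˡ-≤-nonNeg b {{ℚ.nonNegative (ℚ.≤-trans 0≤a a≤b)}} c≤d)

  0≤* : ∀ {a b} → 0ℚ ≤ a → 0ℚ ≤ b → 0ℚ ≤ a * b
  0≤* {a} {b} 0≤a 0≤b = ℚ.nonNegative⁻¹ (a * b)
    {{ℚ.nonNeg*nonNeg⇒nonNeg a {{ℚ.nonNegative 0≤a}} b {{ℚ.nonNegative 0≤b}}}}

  0<* : ∀ {a b} → 0ℚ < a → 0ℚ < b → 0ℚ < a * b
  0<* {a} {b} 0<a 0<b = ℚ.positive⁻¹ (a * b)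
    {{ℚ.pos*pos⇒pos a {{ℚ.positive 0<a}} b {{ℚ.positive 0<b}}}}

  0≤+ : ∀ {a b} → 0ℚ ≤ a → 0ℚ ≤ b → 0ℚ ≤ a + b
  0≤+ = ℚ.+-mono-≤

  p≤p+q : ∀ p {q} → 0ℚ ≤ q → p ≤ p + q
  p≤p+q p {q} 0≤q = ≤-by (sym (ℚ.+-identityʳ p)) (ℚ.+-monoʳ-≤ p 0≤q)

  p<p+q : ∀ p {q} → 0ℚ < q → p < p + q
  p<p+q p {q} 0<q = subst (_< p + q) (ℚ.+-identityʳ p) (ℚ.+-monoʳ-< p 0<q)

  p-q<r⇒p<q+r : ∀ {p q r} → p - q < r → p < q + r
  p-q<r⇒p<q+r {p} {q} {r} lt = subst (_< q + r)
    (solve 2 (λ p q → q :+ (p :- q) := p) refl p q) (ℚ.+-monoʳ-< q lt)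

  p<q+r⇒p-q<r : ∀ {p q r} → p < q + r → p - q < r
  p<q+r⇒p-q<r {p} {q} {r} lt = subst (p - q <_)
    (solve 2 (λ q r → q :+ r :- q := r) refl q r) (ℚ.+-monoˡ-< (- q) lt)

  p≤∣p∣ : ∀ p → p ≤ ∣ p ∣
  p≤∣p∣ p with ℚ.≤-total 0ℚ p
  ... | inj₁ 0≤p = ℚ.≤-reflexive (sym (ℚ.0≤p⇒∣p∣≡p 0≤p))
  ... | inj₂ p≤0 = ℚ.≤-trans p≤0 (ℚ.0≤∣p∣ p)

  ∣p-q∣≡∣q-p∣ : ∀ p q → ∣ p - q ∣ ≡ ∣ q - p ∣
  ∣p-q∣≡∣q-p∣ p q = trans (sym (ℚ.∣-p∣≡∣p∣ (p - q)))
    (cong ∣_∣ (solve 2 (λ p q → :- (p :- q) := q :- p) refl p q))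

  ∣p-q∣<r⇒p<q+r : ∀ {p q r} → ∣ p - q ∣ < r → p < q + r
  ∣p-q∣<r⇒p<q+r {p} {q} lt = p-q<r⇒p<q+r (ℚ.≤-<-trans (p≤∣p∣ (p - q)) lt)

  ∣-∣-< : ∀ p q {r} → p < q + r → q < p + r → ∣ p - q ∣ < r
  ∣-∣-< p q {r} p<q+r q<p+r with ℚ.∣p∣≡p∨∣p∣≡-p (p - q)
  ... | inj₁ eq = subst (_< r) (sym eq) (p<q+r⇒p-q<r p<q+r)
  ... | inj₂ eq = subst (_< r)
    (sym (trans eq (solve 2 (λ p q → :- (p :- q) := q :- p) refl p q)))
    (p<q+r⇒p-q<r q<p+r)

  ½+½ : ∀ p → ½ * p + ½ * p ≡ p
  ½+½ p = trans (sym (ℚ.*-distribʳ-+ p ½ ½)) (ℚ.*-identityˡ p)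

  0<½* : ∀ {p} → 0ℚ < p → 0ℚ < ½ * p
  0<½* = 0<* {½} (ℚ.positive⁻¹ ½)

  ½*<  : ∀ {p} → 0ℚ < p → ½ * p < p
  ½*< {p} 0<p = subst (½ * p <_) (½+½ p) (p<p+q (½ * p) (0<½* 0<p))

  1/-pos : ∀ {p} (0<p : 0ℚ < p) → 0ℚ < (1/ p) {{ℚ.>-nonZero 0<p}}
  1/-pos {p} 0<p = ℚ.positive⁻¹ _ {{ℚ.1/pos⇒pos p {{ℚ.positive 0<p}}}}

  ∣*∣-< : ∀ p q r {B} (0<B : 0ℚ < B) →
          ∣ p ∣ < r * (1/ B) {{ℚ.>-nonZero 0<B}} → ∣ q ∣ ≤ B → ∣ p * q ∣ < r
  ∣*∣-< p q r {B} 0<B p< q≤ = begin-strict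
    ∣ p * q ∣      ≡⟨ ℚ.∣p*q∣≡∣p∣*∣q∣ p q ⟩
    ∣ p ∣ * ∣ q ∣  ≤⟨ ℚ.*-monoˡ-≤-nonNeg ∣ p ∣ {{ℚ.nonNegative (ℚ.0≤∣p∣ p)}} q≤ ⟩
    ∣ p ∣ * B      <⟨ ℚ.*-monoˡ-<-pos B {{ℚ.positive 0<B}} p< ⟩
    r * 1/B * B    ≡⟨ ℚ.*-assoc r 1/B B ⟩
    r * (1/B * B)  ≡⟨ cong (r *_) (ℚ.*-inverseˡ B {{ℚ.>-nonZero 0<B}}) ⟩
    r * 1ℚ         ≡⟨ ℚ.*-identityʳ r ⟩
    r              ∎
    where 1/B = (1/ B) {{ℚ.>-nonZero 0<B}}

  product-close : ∀ a b c d r {A B} (0<A : 0ℚ < A) (0<B : 0ℚ < B) →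
    ∣ b ∣ ≤ B → ∣ c ∣ ≤ A →
    ∣ a - c ∣ < ½ * r * (1/ B) {{ℚ.>-nonZero 0<B}} →
    ∣ b - d ∣ < ½ * r * (1/ A) {{ℚ.>-nonZero 0<A}} →
    ∣ a * b - c * d ∣ < r
  product-close a b c d r 0<A 0<B b≤ c≤ a-c< b-d< = begin-strict
    ∣ a * b - c * d ∣
      ≡⟨ cong ∣_∣ (solve 4 (λ a b c d → a :* b :- c :* d := (a :- c) :* b :+ (b :- d) :* c)
                           refl a b c d) ⟩
    ∣ (a - c) * b + (b - d) * c ∣          ≤⟨ ℚ.∣p+q∣≤∣p∣+∣q∣ ((a - c) * b) ((b - d) * c) ⟩
    ∣ (a - c) * b ∣ + ∣ (b - d) * c ∣
      <⟨ ℚ.+-mono-< (∣*∣-< (a - c) b (½ * r) 0<B a-c< b≤) (∣*∣-< (b - d) c (½ * r) 0<A b-d< c≤) ⟩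
    ½ * r + ½ * r                          ≡⟨ ½+½ r ⟩
    r                                      ∎

  toℚᵘ-/ : ∀ i d .{{_ : NonZero d}} → ℚ.toℚᵘ (i / d) ℚᵘ.≃ (i ℚᵘ./ d)
  toℚᵘ-/ i (suc d) = ℚ.toℚᵘ-fromℚᵘ (ℚᵘ.mkℚᵘ i d)

  /-mono-≤ : ∀ i j a b .{{_ : NonZero a}} .{{_ : NonZero b}} →
             i ℤ.* ℤ.+ b ℤ.≤ j ℤ.* ℤ.+ a → i / a ≤ j / b
  /-mono-≤ i j (suc a) (suc b) le = ℚ.toℚᵘ-cancel-≤
    (ℚᵘ.≤-respʳ-≃ (ℚᵘ.≃-sym (toℚᵘ-/ j (suc b)))
      (ℚᵘ.≤-respˡ-≃ (ℚᵘ.≃-sym (toℚᵘ-/ i (suc a))) (ℚᵘ.*≤* le)))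

  /1-mono-≤ : ∀ {a b} → a ℕ.≤ b → ℤ.+ a / 1 ≤ ℤ.+ b / 1
  /1-mono-≤ {a} {b} a≤b = /-mono-≤ (ℤ.+ a) (ℤ.+ b) 1 1 (ℤ.*-monoʳ-≤-nonNeg (ℤ.+ 1) (ℤ.+≤+ a≤b))

  1/n-antimono : ∀ {a b} .{{_ : NonZero a}} .{{_ : NonZero b}} →
                 a ℕ.≤ b → ℤ.+ 1 / b ≤ ℤ.+ 1 / a
  1/n-antimono {a} {b} a≤b = /-mono-≤ (ℤ.+ 1) (ℤ.+ 1) b a
    (ℤ.*-monoˡ-≤-nonNeg (ℤ.+ 1) (ℤ.+≤+ a≤b))

  0≤n/d : ∀ n d .{{_ : NonZero d}} → 0ℚ ≤ ℤ.+ n / d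
  0≤n/d n d = ℚ.nonNegative⁻¹ _ {{ℚ.normalize-nonNeg n d}}

  n/n≡1 : ∀ n .{{_ : NonZero n}} → ℤ.+ n / n ≡ 1ℚ
  n/n≡1 (suc n) = ℚ.toℚᵘ-injective (ℚᵘ.≃-trans (toℚᵘ-/ (ℤ.+ suc n) (suc n))
    (ℚᵘ.*≡* (ℤ.*-comm (ℤ.+ suc n) (ℤ.+ 1))))

  [1+k]/d : ∀ k d .{{_ : NonZero d}} → ℤ.+ suc k / d ≡ ℤ.+ k / d + ℤ.+ 1 / d
  [1+k]/d k (suc d) = ℚ.toℚᵘ-injective (ℚᵘ.≃-trans (toℚᵘ-/ (ℤ.+ suc k) (suc d))
    (ℚᵘ.≃-sym (ℚᵘ.≃-trans (ℚ.toℚᵘ-homo-+ (ℤ.+ k / suc d) (ℤ.+ 1 / suc d))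
      (ℚᵘ.≃-trans (ℚᵘ.+-cong (toℚᵘ-/ (ℤ.+ k) (suc d)) (toℚᵘ-/ (ℤ.+ 1) (suc d)))
        (ℚᵘ.*≡* eq)))))
    where
    open import Data.Integer.Solver using () renaming (module +-*-Solver to ℤSolver)
    eq : (ℤ.+ k ℤ.* ℤ.+ suc d ℤ.+ ℤ.+ 1 ℤ.* ℤ.+ suc d) ℤ.* ℤ.+ suc d
         ≡ ℤ.+ suc k ℤ.* (ℤ.+ suc d ℤ.* ℤ.+ suc d)
    eq = trans (ℤSolver.solve 3
        (λ k o d → (k ℤSolver.:* d ℤSolver.:+ o ℤSolver.:* d) ℤSolver.:* d
          ℤSolver.:= (o ℤSolver.:+ k) ℤSolver.:* (d ℤSolver.:* d))
        refl (ℤ.+ k) (ℤ.+ 1) (ℤ.+ suc d))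
      refl

  [k*d]/d : ∀ k d .{{_ : NonZero d}} → ℤ.+ (k ℕ.* d) / d ≡ ℤ.+ k / 1
  [k*d]/d k (suc d) = ℚ.toℚᵘ-injective (ℚᵘ.≃-trans (toℚᵘ-/ (ℤ.+ (k ℕ.* suc d)) (suc d))
    (ℚᵘ.≃-trans (ℚᵘ.*≡* (trans (ℤ.*-identityʳ _) (ℤ.pos-* k (suc d))))
      (ℚᵘ.≃-sym (toℚᵘ-/ (ℤ.+ k) 1))))

  archimedean : ∀ {ε} → 0ℚ < ε → ∃[ N ] ∀ m → N ℕ.≤ m → ℤ.+ 1 / suc m ≤ ε
  archimedean {mkℚ (ℤ.+ suc p) d-1 c} 0<ε = suc d-1 , λ m d≤m →
    ≤-trans-ε m (ℕ.≤-trans d≤m (ℕ.n≤1+n m))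
    where
    ε = mkℚ (ℤ.+ suc p) d-1 c
    ≤-trans-ε : ∀ m → suc d-1 ℕ.≤ suc m → ℤ.+ 1 / suc m ≤ ε
    ≤-trans-ε m d≤m = subst (ℤ.+ 1 / suc m ≤_) (ℚ.↥p/↧p≡p ε)
      (/-mono-≤ (ℤ.+ 1) (ℤ.+ suc p) (suc m) (suc d-1)
        (ℤ.+≤+ (ℕ.*-mono-≤ {1} {suc p} {suc d-1} {suc m} (ℕ.s≤s ℕ.z≤n) d≤m)))
  archimedean {mkℚ (ℤ.+ zero) d-1 c} (ℚ.*<* (ℤ.+<+ lt)) = ⊥-elim (ℕ.<-irrefl refl lt)
  archimedean {mkℚ ℤ.-[1+ p ] d-1 c} (ℚ.*<* ())

  p≤∣↥p∣ : ∀ p → p ≤ ℤ.+ ℤ.∣ ℚ.↥ p ∣ / 1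
  p≤∣↥p∣ p = subst (_≤ ℤ.+ ℤ.∣ ℚ.↥ p ∣ / 1) (ℚ.↥p/↧p≡p p) (lem p)
    where
    lem : ∀ p → (ℚ.↥ p / ℚ.↧ₙ p) ≤ ℤ.+ ℤ.∣ ℚ.↥ p ∣ / 1
    lem (mkℚ (ℤ.+ n) d-1 c) = /-mono-≤ (ℤ.+ n) (ℤ.+ n) (suc d-1) 1
      (ℤ.*-monoˡ-≤-nonNeg (ℤ.+ n) (ℤ.+≤+ (ℕ.s≤s ℕ.z≤n)))
    lem (mkℚ ℤ.-[1+ n ] d-1 c) = /-mono-≤ (ℤ.-[1+ n ]) (ℤ.+ suc n) (suc d-1) 1
      ℤ.-≤+

  infix 9 _⁴
  _⁴ : ℚ → ℚ
  p ⁴ = (p * p) * (p * p)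

  ⁴-mono-≤ : ∀ {p q} → 0ℚ ≤ p → p ≤ q → p ⁴ ≤ q ⁴
  ⁴-mono-≤ 0≤p p≤q = *-mono-≤ (0≤* 0≤p 0≤p) p²≤q² (0≤* 0≤p 0≤p) p²≤q²
    where p²≤q² = *-mono-≤ 0≤p p≤q 0≤p p≤q

  0<⁴ : ∀ {p} → 0ℚ < p → 0ℚ < p ⁴
  0<⁴ 0<p = 0<* (0<* 0<p 0<p) (0<* 0<p 0<p)

  p≤p⁴ : ∀ {p} → 1ℚ ≤ p → p ≤ p ⁴
  p≤p⁴ {p} 1≤p = begin
    p              ≡⟨ solve 1 (λ p → p := p :* con 1ℚ :* (con 1ℚ :* con 1ℚ)) refl p ⟩
    p * 1ℚ * (1ℚ * 1ℚ) ≤⟨ *-mono-≤ (0≤* 0≤p 0≤1) (*-mono-≤ 0≤p ℚ.≤-refl 0≤1 1≤p)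
                                     0≤1 (*-mono-≤ 0≤1 1≤p 0≤1 1≤p) ⟩
    p ⁴            ∎
    where
    0≤1 : 0ℚ ≤ 1ℚ
    0≤1 = ℚ.nonNegative⁻¹ 1ℚ
    0≤p = ℚ.≤-trans 0≤1 1≤p

  ⁴-superadditive : ∀ {p q} → 0ℚ ≤ p → 0ℚ ≤ q → p ⁴ + q ⁴ ≤ (p + q) ⁴
  ⁴-superadditive {p} {q} 0≤p 0≤q = ℚ.≤-trans
    (²-superadditive (0≤* 0≤p 0≤p) (0≤* 0≤q 0≤q))
    (*-mono-≤ 0≤p²+q² (²-superadditive 0≤p 0≤q) 0≤p²+q² (²-superadditive 0≤p 0≤q))
    where
    0≤p²+q² = 0≤+ (0≤* 0≤p 0≤p) (0≤* 0≤q 0≤q)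
    ²-superadditive : ∀ {p q} → 0ℚ ≤ p → 0ℚ ≤ q → p * p + q * q ≤ (p + q) * (p + q)
    ²-superadditive {p} {q} 0≤p 0≤q = subst (p * p + q * q ≤_)
      (solve 2 (λ p q → p :* p :+ q :* q :+ (p :* q :+ p :* q) := (p :+ q) :* (p :+ q)) refl p q)
      (p≤p+q (p * p + q * q) (0≤+ (0≤* 0≤p 0≤q) (0≤* 0≤p 0≤q)))

open RationalLemmas using (_⁴)

------------------------------------------------------------------------
-- Real numbers as Cauchy sequences of rationals

record ℝ : Set where
  constructor mkℝ
  field
    seq    : ℕ → ℚ
    cauchy : ∀ {ε} → 0ℚ ℚ.< ε →
             ∃[ N ] ∀ m n → N ℕ.≤ m → N ℕ.≤ n → ℚ.∣ seq m ℚ.- seq n ∣ ℚ.< ε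

open ℝ public

infix 4 _≤_ _<_ _≃_

_≤_ : ℝ → ℝ → Set
x ≤ y = ∀ {ε} → 0ℚ ℚ.< ε → ∃[ N ] ∀ n → N ℕ.≤ n → seq x n ℚ.≤ seq y n ℚ.+ ε

_<_ : ℝ → ℝ → Set
x < y = ∃[ ε ] 0ℚ ℚ.< ε × (∃[ N ] ∀ n → N ℕ.≤ n → seq x n ℚ.+ ε ℚ.≤ seq y n)

_≃_ : ℝ → ℝ → Set
x ≃ y = x ≤ y × y ≤ x

module _ where

  open RationalLemmas
  open import Data.Rational.Solver using (module +-*-Solver)
  open +-*-Solver using (solve; _:=_; _:+_; _:*_; _:-_; :-_)

  fromℚ : ℚ → ℝ
  fromℚ q .seq _ = q
  fromℚ q .cauchy {ε} 0<ε = 0 , λ _ _ _ _ → ∣-∣-< q q (p<p+q q 0<ε) (p<p+q q 0<ε)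

  fromℕ : ℕ → ℝ
  fromℕ n = fromℚ (ℤ.+ n ℚ./ 1)

  0ℝ 1ℝ : ℝ
  0ℝ = fromℚ 0ℚ
  1ℝ = fromℚ 1ℚ

  infix  8 -_
  infixl 7 _*_
  infixl 6 _+_ _-_

  _+_ : ℝ → ℝ → ℝ
  (x + y) .seq n = seq x n ℚ.+ seq y n
  (x + y) .cauchy {ε} 0<ε
    with cauchy x (0<½* 0<ε) | cauchy y (0<½* 0<ε)
  ... | M , hx | N , hy = M ℕ.⊔ N , step
    where
    step : ∀ m n → M ℕ.⊔ N ℕ.≤ m → M ℕ.⊔ N ℕ.≤ n →
           ℚ.∣ (seq x m ℚ.+ seq y m) ℚ.- (seq x n ℚ.+ seq y n) ∣ ℚ.< ε
    step m n m≥ n≥ = begin-strict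
      ℚ.∣ (a ℚ.+ b) ℚ.- (c ℚ.+ d) ∣
        ≡⟨ cong ℚ.∣_∣ (solve 4 (λ a b c d → (a :+ b) :- (c :+ d) := (a :- c) :+ (b :- d))
                              refl a b c d) ⟩
      ℚ.∣ (a ℚ.- c) ℚ.+ (b ℚ.- d) ∣ ≤⟨ ℚ.∣p+q∣≤∣p∣+∣q∣ (a ℚ.- c) (b ℚ.- d) ⟩
      ℚ.∣ a ℚ.- c ∣ ℚ.+ ℚ.∣ b ℚ.- d ∣
        <⟨ ℚ.+-mono-< (hx m n (ℕ.m⊔n≤o⇒m≤o M N m≥) (ℕ.m⊔n≤o⇒m≤o M N n≥))
                      (hy m n (ℕ.m⊔n≤o⇒n≤o M N m≥) (ℕ.m⊔n≤o⇒n≤o M N n≥)) ⟩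
      ½ ℚ.* ε ℚ.+ ½ ℚ.* ε ≡⟨ ½+½ ε ⟩
      ε ∎
      where
      open ℚ.≤-Reasoning
      a = seq x m ; b = seq y m ; c = seq x n ; d = seq y n

  -_ : ℝ → ℝ
  (- x) .seq n = ℚ.- seq x n
  (- x) .cauchy {ε} 0<ε with cauchy x 0<ε
  ... | N , h = N , λ m n m≥ n≥ → subst (λ q → ℚ.∣ q ∣ ℚ.< ε)
    (solve 2 (λ a b → b :- a := :- a :- :- b) refl (seq x m) (seq x n)) (h n m n≥ m≥)

  _-_ : ℝ → ℝ → ℝ
  x - y = x + (- y)

  eventually-bounded : ∀ x → ∃[ B ] 0ℚ ℚ.< B × (∃[ N ] ∀ n → N ℕ.≤ n → ℚ.∣ seq x n ∣ ℚ.≤ B)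
  eventually-bounded x with cauchy x (ℚ.positive⁻¹ 1ℚ)
  ... | N , h = ℚ.∣ a ∣ ℚ.+ 1ℚ
              , ℚ.≤-<-trans (ℚ.0≤∣p∣ a) (p<p+q _ (ℚ.positive⁻¹ 1ℚ))
              , N , λ n n≥ → bound n (h n N n≥ ℕ.≤-refl)
    where
    a = seq x N
    bound : ∀ n → ℚ.∣ seq x n ℚ.- a ∣ ℚ.< 1ℚ → ℚ.∣ seq x n ∣ ℚ.≤ ℚ.∣ a ∣ ℚ.+ 1ℚ
    bound n lt = begin
      ℚ.∣ b ∣                       ≡⟨ cong ℚ.∣_∣ (solve 2 (λ a b → b := a :+ (b :- a)) refl a b) ⟩
      ℚ.∣ a ℚ.+ (b ℚ.- a) ∣         ≤⟨ ℚ.∣p+q∣≤∣p∣+∣q∣ a (b ℚ.- a) ⟩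
      ℚ.∣ a ∣ ℚ.+ ℚ.∣ b ℚ.- a ∣     ≤⟨ ℚ.+-monoʳ-≤ ℚ.∣ a ∣ (ℚ.<⇒≤ lt) ⟩
      ℚ.∣ a ∣ ℚ.+ 1ℚ                ∎
      where
      open ℚ.≤-Reasoning
      b = seq x n

  _*_ : ℝ → ℝ → ℝ
  (x * y) .seq n = seq x n ℚ.* seq y n
  (x * y) .cauchy {ε} 0<ε =
    let A , 0<A , K , hA = eventually-bounded x
        B , 0<B , L , hB = eventually-bounded y
        0<1/A = 1/-pos 0<A
        0<1/B = 1/-pos 0<B
        M , hx = cauchy x {½ ℚ.* ε ℚ.* (ℚ.1/ B) {{ℚ.>-nonZero 0<B}}}
                   (0<* {½ ℚ.* ε} {(ℚ.1/ B) {{ℚ.>-nonZero 0<B}}} (0<½* {ε} 0<ε) 0<1/B)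
        N , hy = cauchy y {½ ℚ.* ε ℚ.* (ℚ.1/ A) {{ℚ.>-nonZero 0<A}}}
                   (0<* {½ ℚ.* ε} {(ℚ.1/ A) {{ℚ.>-nonZero 0<A}}} (0<½* {ε} 0<ε) 0<1/A)
        inK = λ {i} (i≥ : K ℕ.⊔ L ℕ.⊔ (M ℕ.⊔ N) ℕ.≤ i) →
                ℕ.m⊔n≤o⇒m≤o K L (ℕ.m⊔n≤o⇒m≤o (K ℕ.⊔ L) (M ℕ.⊔ N) i≥)
        inL = λ {i} (i≥ : K ℕ.⊔ L ℕ.⊔ (M ℕ.⊔ N) ℕ.≤ i) →
                ℕ.m⊔n≤o⇒n≤o K L (ℕ.m⊔n≤o⇒m≤o (K ℕ.⊔ L) (M ℕ.⊔ N) i≥)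
        inM = λ {i} (i≥ : K ℕ.⊔ L ℕ.⊔ (M ℕ.⊔ N) ℕ.≤ i) →
                ℕ.m⊔n≤o⇒m≤o M N (ℕ.m⊔n≤o⇒n≤o (K ℕ.⊔ L) (M ℕ.⊔ N) i≥)
        inN = λ {i} (i≥ : K ℕ.⊔ L ℕ.⊔ (M ℕ.⊔ N) ℕ.≤ i) →
                ℕ.m⊔n≤o⇒n≤o M N (ℕ.m⊔n≤o⇒n≤o (K ℕ.⊔ L) (M ℕ.⊔ N) i≥)
    in K ℕ.⊔ L ℕ.⊔ (M ℕ.⊔ N) , λ m n m≥ n≥ →
      product-close (seq x m) (seq y m) (seq x n) (seq y n) ε 0<A 0<B
        (hB m (inL m≥)) (hA n (inK n≥)) (hx m n (inM m≥) (inM n≥)) (hy m n (inN m≥) (inN n≥))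

  -- 1/ q for q ≠ 0, and 0 otherwise
  recipℚ : ℚ → ℚ
  recipℚ q with q ℚ.≟ 0ℚ
  ... | yes _  = 0ℚ
  ... | no q≢0 = (ℚ.1/ q) {{ℚ.≢-nonZero q≢0}}

  recipℚ-inverse : ∀ {q} → 0ℚ ℚ.< q → recipℚ q ℚ.* q ≡ 1ℚ
  recipℚ-inverse {q} 0<q with q ℚ.≟ 0ℚ
  ... | yes q≡0 = ⊥-elim (ℚ.<⇒≢ 0<q (sym q≡0))
  ... | no q≢0  = ℚ.*-inverseˡ q {{ℚ.≢-nonZero q≢0}}

  recip : ∀ x → 0ℝ < x → ℝ
  recip x _ .seq n = recipℚ (seq x n)
  recip x (δ , 0<δ , K , h) .cauchy {ε} 0<ε with cauchy x (0<* 0<ε (0<* 0<δ 0<δ))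
  ... | N , hx = K ℕ.⊔ N , λ m n m≥ n≥ →
      one-sided (h' m m≥) (h' n n≥) (hx m n (ℕ.m⊔n≤o⇒n≤o K N m≥) (ℕ.m⊔n≤o⇒n≤o K N n≥))
    where
    open ℚ.≤-Reasoning
    h' : ∀ n → K ℕ.⊔ N ℕ.≤ n → δ ℚ.≤ seq x n
    h' n n≥ = ≤-by (sym (ℚ.+-identityˡ δ)) (h n (ℕ.m⊔n≤o⇒m≤o K N n≥))
    one-sided : ∀ {a b} → δ ℚ.≤ a → δ ℚ.≤ b → ℚ.∣ a ℚ.- b ∣ ℚ.< ε ℚ.* (δ ℚ.* δ) →
                ℚ.∣ recipℚ a ℚ.- recipℚ b ∣ ℚ.< ε
    one-sided {a} {b} δ≤a δ≤b lt =
      ℚ.*-cancelʳ-<-nonNeg (δ ℚ.* δ) {{ℚ.nonNegative (0≤* 0≤δ 0≤δ)}} (begin-strict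
        ℚ.∣ u ℚ.- v ∣ ℚ.* (δ ℚ.* δ)
          ≤⟨ *-mono-≤ (ℚ.0≤∣p∣ (u ℚ.- v)) ℚ.≤-refl (0≤* 0≤δ 0≤δ) (*-mono-≤ 0≤δ δ≤a 0≤δ δ≤b) ⟩
        ℚ.∣ u ℚ.- v ∣ ℚ.* (a ℚ.* b)
          ≡⟨ cong (ℚ.∣ u ℚ.- v ∣ ℚ.*_)
               (sym (ℚ.0≤p⇒∣p∣≡p (0≤* (ℚ.≤-trans 0≤δ δ≤a) (ℚ.≤-trans 0≤δ δ≤b)))) ⟩
        ℚ.∣ u ℚ.- v ∣ ℚ.* ℚ.∣ a ℚ.* b ∣ ≡⟨ sym (ℚ.∣p*q∣≡∣p∣*∣q∣ (u ℚ.- v) (a ℚ.* b)) ⟩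
        ℚ.∣ (u ℚ.- v) ℚ.* (a ℚ.* b) ∣
          ≡⟨ cong ℚ.∣_∣ (solve 4 (λ u v a b → (u :- v) :* (a :* b)
                := (u :* a) :* b :- (v :* b) :* a) refl u v a b) ⟩
        ℚ.∣ (u ℚ.* a) ℚ.* b ℚ.- (v ℚ.* b) ℚ.* a ∣
          ≡⟨ cong₂ (λ p q → ℚ.∣ p ℚ.* b ℚ.- q ℚ.* a ∣)
               (recipℚ-inverse (ℚ.<-≤-trans 0<δ δ≤a)) (recipℚ-inverse (ℚ.<-≤-trans 0<δ δ≤b)) ⟩
        ℚ.∣ 1ℚ ℚ.* b ℚ.- 1ℚ ℚ.* a ∣
          ≡⟨ cong₂ (λ p q → ℚ.∣ p ℚ.- q ∣) (ℚ.*-identityˡ b) (ℚ.*-identityˡ a) ⟩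
        ℚ.∣ b ℚ.- a ∣ ≡⟨ ∣p-q∣≡∣q-p∣ b a ⟩
        ℚ.∣ a ℚ.- b ∣ <⟨ lt ⟩
        ε ℚ.* (δ ℚ.* δ) ∎)
      where
      u = recipℚ a ; v = recipℚ b
      0≤δ = ℚ.<⇒≤ 0<δ

------------------------------------------------------------------------
-- Fourth roots

greatest : ∀ {P : ℕ → Set} → Decidable P → ℕ → ℕ
greatest P? zero    = zero
greatest P? (suc b) with P? (suc b)
... | yes _ = suc b
... | no _  = greatest P? b

greatest-satisfies : ∀ {P : ℕ → Set} (P? : Decidable P) b → P 0 → P (greatest P? b)
greatest-satisfies P? zero    P0 = P0
greatest-satisfies P? (suc b) P0 with P? (suc b)
... | yes p = p
... | no _  = greatest-satisfies P? b P0

greatest-maximal : ∀ {P : ℕ → Set} (P? : Decidable P) b {k} → k ℕ.≤ b → P k → k ℕ.≤ greatest P? b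
greatest-maximal P? zero    k≤b Pk = k≤b
greatest-maximal P? (suc b) k≤b Pk with P? (suc b)
... | yes _ = k≤b
... | no ¬p with ℕ.m≤n⇒m<n∨m≡n k≤b
...   | inj₁ (ℕ.s≤s k≤b') = greatest-maximal P? b k≤b' Pk
...   | inj₂ refl         = ⊥-elim (¬p Pk)

module _ where

  open RationalLemmas hiding (_⁴)
  open import Data.Rational.Solver using (module +-*-Solver)
  open +-*-Solver using (solve; _:=_; _:+_; _:*_)

  -- A record rather than a plain definition, so that the fractions inside are
  -- not normalised during type checking.
  record FourthPowerBelow (n : ℕ) (q : ℚ) (k : ℕ) : Set where
    constructor below
    field is-below : (ℤ.+ k ℚ./ suc n) ⁴ ℚ.≤ q ℚ.⊔ 0ℚ

  open FourthPowerBelow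

  fourthPowerBelow? : ∀ n q → Decidable (FourthPowerBelow n q)
  fourthPowerBelow? n q k = map′ below is-below ((ℤ.+ k ℚ./ suc n) ⁴ ℚ.≤? q ℚ.⊔ 0ℚ)

  searchBound : ℕ → ℚ → ℕ
  searchBound n q = suc ℤ.∣ ℚ.↥ q ∣ ℕ.* suc n

  searchBound-correct : ∀ n q {k} → FourthPowerBelow n q k → k ℕ.≤ searchBound n q
  searchBound-correct n q {k} Pk with k ℕ.≤? searchBound n q
  ... | yes k≤b = k≤b
  ... | no k≰b = ⊥-elim (ℚ.<-irrefl refl (begin-strict
      q ℚ.⊔ 0ℚ                    ≤⟨ ℚ.⊔-lub (p≤∣↥p∣ q) (0≤n/d ∣↥q∣ 1) ⟩
      ℤ.+ ∣↥q∣ ℚ./ 1              <⟨ p<p+q _ (ℚ.positive⁻¹ 1ℚ) ⟩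
      ℤ.+ ∣↥q∣ ℚ./ 1 ℚ.+ 1ℚ       ≡⟨ sym ([1+k]/d ∣↥q∣ 1) ⟩
      B                           ≤⟨ p≤p⁴ (/1-mono-≤ {1} {suc ∣↥q∣} (ℕ.s≤s ℕ.z≤n)) ⟩
      B ⁴                         ≤⟨ ⁴-mono-≤ (0≤n/d (suc ∣↥q∣) 1) B≤k ⟩
      (ℤ.+ k ℚ./ suc n) ⁴         ≤⟨ is-below Pk ⟩
      q ℚ.⊔ 0ℚ                    ∎))
    where
    open ℚ.≤-Reasoning
    ∣↥q∣ = ℤ.∣ ℚ.↥ q ∣
    B = ℤ.+ suc ∣↥q∣ ℚ./ 1
    B≤k : B ℚ.≤ ℤ.+ k ℚ./ suc n
    B≤k = ≤-by (sym ([k*d]/d (suc ∣↥q∣) (suc n)))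
      (/-mono-≤ (ℤ.+ searchBound n q) (ℤ.+ k) (suc n) (suc n)
        (ℤ.*-monoʳ-≤-nonNeg (ℤ.+ suc n) (ℤ.+≤+ (ℕ.<⇒≤ (ℕ.≰⇒> k≰b)))))

  opaque
    root⁴ℕ : ℕ → ℚ → ℕ
    root⁴ℕ n q = greatest (fourthPowerBelow? n q) (searchBound n q)

    root⁴ℕ-satisfies : ∀ n q → FourthPowerBelow n q 0 → FourthPowerBelow n q (root⁴ℕ n q)
    root⁴ℕ-satisfies n q =
      greatest-satisfies {FourthPowerBelow n q} (fourthPowerBelow? n q) (searchBound n q)

    root⁴ℕ-maximal : ∀ n q {k} → k ℕ.≤ searchBound n q → FourthPowerBelow n q k →
                     k ℕ.≤ root⁴ℕ n q
    root⁴ℕ-maximal n q =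
      greatest-maximal {FourthPowerBelow n q} (fourthPowerBelow? n q) (searchBound n q)

  opaque
    -- the greatest multiple of 1/(n+1) whose fourth power is at most  max q 0
    root⁴ℚ : ℕ → ℚ → ℚ
    root⁴ℚ n q = ℤ.+ root⁴ℕ n q ℚ./ suc n

    0≤root⁴ℚ : ∀ n q → 0ℚ ℚ.≤ root⁴ℚ n q
    0≤root⁴ℚ n q = 0≤n/d (root⁴ℕ n q) (suc n)

    root⁴ℚ-lower : ∀ n q → root⁴ℚ n q ⁴ ℚ.≤ q ℚ.⊔ 0ℚ
    root⁴ℚ-lower n q = is-below (root⁴ℕ-satisfies n q (below
      (subst (λ p → p ⁴ ℚ.≤ q ℚ.⊔ 0ℚ) (sym (ℚ.0/n≡0 (suc n))) (ℚ.p≤q⊔p q 0ℚ))))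

    root⁴ℚ-upper : ∀ n q → q ℚ.⊔ 0ℚ ℚ.< (root⁴ℚ n q ℚ.+ ℤ.+ 1 ℚ./ suc n) ⁴
    root⁴ℚ-upper n q = ℚ.≰⇒> λ le →
      let Pk = below (subst (λ p → p ⁴ ℚ.≤ q ℚ.⊔ 0ℚ) (sym ([1+k]/d (root⁴ℕ n q) (suc n))) le)
      in ℕ.<-irrefl refl (root⁴ℕ-maximal n q
           (searchBound-correct n q Pk) Pk)

    root⁴ℚ-maximal : ∀ n q k → (ℤ.+ k ℚ./ suc n) ⁴ ℚ.≤ q ℚ.⊔ 0ℚ → ℤ.+ k ℚ./ suc n ℚ.≤ root⁴ℚ n q
    root⁴ℚ-maximal n q k le =
      /-mono-≤ (ℤ.+ k) (ℤ.+ root⁴ℕ n q) (suc n) (suc n)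
        (ℤ.*-monoʳ-≤-nonNeg (ℤ.+ suc n) (ℤ.+≤+
          (root⁴ℕ-maximal n q (searchBound-correct n q {k} (below le)) (below le))))

  ⊔0-< : ∀ p q r → 0ℚ ℚ.< r → p ℚ.< q ℚ.+ r → p ℚ.⊔ 0ℚ ℚ.< q ℚ.⊔ 0ℚ ℚ.+ r
  ⊔0-< p q r 0<r p<q+r with ℚ.≤-total p 0ℚ
  ... | inj₁ p≤0 = subst (ℚ._< q ℚ.⊔ 0ℚ ℚ.+ r) (sym (ℚ.p≤q⇒p⊔q≡q p≤0))
        (ℚ.≤-<-trans (ℚ.p≤q⊔p q 0ℚ) (p<p+q _ 0<r))
  ... | inj₂ 0≤p = subst (ℚ._< q ℚ.⊔ 0ℚ ℚ.+ r) (sym (ℚ.p≥q⇒p⊔q≡p 0≤p))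
        (ℚ.<-≤-trans p<q+r (ℚ.+-monoˡ-≤ r (ℚ.p≤p⊔q q 0ℚ)))

  -- ∜ x is the fourth root of  max x 0.
  infix 9 ∜_
  ∜_ : ℝ → ℝ
  (∜ x) .seq n = root⁴ℚ n (seq x n)
  (∜ x) .cauchy {ε} 0<ε
    with archimedean (0<½* 0<ε) | cauchy x (0<⁴ (0<½* 0<ε))
  ... | M , hM | N , hx = M ℕ.⊔ N , λ m n m≥ n≥ →
      ∣-∣-< (root m) (root n)
        (close m n (hM n (inM n≥)) (hx m n (inN m≥) (inN n≥)))
        (close n m (hM m (inM m≥)) (hx n m (inN n≥) (inN m≥)))
    where
    open ℚ.≤-Reasoning
    inM : ∀ {i} → M ℕ.⊔ N ℕ.≤ i → M ℕ.≤ i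
    inM = ℕ.m⊔n≤o⇒m≤o M N
    inN : ∀ {i} → M ℕ.⊔ N ℕ.≤ i → N ℕ.≤ i
    inN = ℕ.m⊔n≤o⇒n≤o M N
    root : ℕ → ℚ
    root n = root⁴ℚ n (seq x n)
    h = ½ ℚ.* ε
    close : ∀ m n → ℤ.+ 1 ℚ./ suc n ℚ.≤ h → ℚ.∣ seq x m ℚ.- seq x n ∣ ℚ.< h ⁴ →
            root m ℚ.< root n ℚ.+ ε
    close m n η≤h lt = ℚ.≰⇒> λ n+ε≤m → ℚ.<-irrefl refl (begin-strict
      seq x m ℚ.⊔ 0ℚ             <⟨ ⊔0-< (seq x m) (seq x n) (h ⁴) (0<⁴ {h} (0<½* {ε} 0<ε))
                                       (∣p-q∣<r⇒p<q+r {seq x m} {seq x n} {h ⁴} lt) ⟩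
      seq x n ℚ.⊔ 0ℚ ℚ.+ h ⁴     ≤⟨ ℚ.+-monoˡ-≤ (h ⁴) (ℚ.<⇒≤ (root⁴ℚ-upper n (seq x n))) ⟩
      (root n ℚ.+ η) ⁴ ℚ.+ h ⁴   ≤⟨ ⁴-superadditive 0≤c 0≤h ⟩
      (root n ℚ.+ η ℚ.+ h) ⁴     ≤⟨ ⁴-mono-≤ (0≤+ 0≤c 0≤h) (begin
          root n ℚ.+ η ℚ.+ h     ≤⟨ ℚ.+-monoˡ-≤ h (ℚ.+-monoʳ-≤ (root n) η≤h) ⟩
          root n ℚ.+ h ℚ.+ h     ≡⟨ ℚ.+-assoc (root n) h h ⟩
          root n ℚ.+ (h ℚ.+ h)   ≡⟨ cong (root n ℚ.+_) (½+½ ε) ⟩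
          root n ℚ.+ ε           ≤⟨ n+ε≤m ⟩
          root m                 ∎) ⟩
      root m ⁴                   ≤⟨ root⁴ℚ-lower m (seq x m) ⟩
      seq x m ℚ.⊔ 0ℚ             ∎)
      where
      η = ℤ.+ 1 ℚ./ suc n
      0≤c = 0≤+ (0≤root⁴ℚ n (seq x n)) (0≤n/d 1 (suc n))
      0≤h = ℚ.<⇒≤ (0<½* 0<ε)

------------------------------------------------------------------------
-- Euler's number

1/! : ℕ → ℚ
1/! n = (ℤ.+ 1 ℚ./ (n !)) {{n ℕ.!≢0}}

-- Σ_{k ≤ n} 1/k!
expSum : ℕ → ℚ
expSum zero    = 1ℚ
expSum (suc n) = expSum n ℚ.+ 1/! (suc n)

module _ where

  open RationalLemmas

  0≤1/! : ∀ n → 0ℚ ℚ.≤ 1/! n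
  0≤1/! n = 0≤n/d 1 (n !) {{n ℕ.!≢0}}

  1/n!-halves : ∀ n → 1 ℕ.≤ n →
    1/! (suc n) ℚ.+ 1/! (suc n) ℚ.≤ 1/! n
  1/n!-halves n 1≤n = ≤-by (sym ([1+k]/d 1 (suc n !) {{suc n ℕ.!≢0}}))
    (/-mono-≤ (ℤ.+ 2) (ℤ.+ 1) (suc n !) (n !) {{suc n ℕ.!≢0}} {{n ℕ.!≢0}}
      (subst₂ ℤ._≤_ (ℤ.pos-* 2 (n !)) (sym (ℤ.*-identityˡ (ℤ.+ (suc n !))))
        (ℤ.+≤+ (ℕ.*-monoˡ-≤ (n !) (ℕ.s≤s 1≤n)))))

  expSum-increasing : ∀ n k → expSum n ℚ.≤ expSum (k ℕ.+ n)
  expSum-increasing n zero    = ℚ.≤-refl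
  expSum-increasing n (suc k) = ℚ.≤-trans (expSum-increasing n k)
    (p≤p+q _ (0≤1/! (suc (k ℕ.+ n))))

  expSum-tail : ∀ n → 1 ℕ.≤ n → ∀ k →
    expSum (k ℕ.+ n) ℚ.+ 1/! (k ℕ.+ n) ℚ.≤ expSum n ℚ.+ 1/! n
  expSum-tail n 1≤n zero    = ℚ.≤-refl
  expSum-tail n 1≤n (suc k) = ℚ.≤-trans
    (≤-by (ℚ.+-assoc (expSum (k ℕ.+ n)) _ _)
      (ℚ.+-monoʳ-≤ (expSum (k ℕ.+ n))
        (1/n!-halves (k ℕ.+ n) (ℕ.≤-trans 1≤n (ℕ.m≤n+m n k)))))
    (expSum-tail n 1≤n k)

  n≤n! : ∀ n → n ℕ.≤ n !
  n≤n! zero    = ℕ.z≤n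
  n≤n! (suc n) = subst (ℕ._≤ suc n !) (ℕ.*-identityʳ (suc n))
    (ℕ.*-monoʳ-≤ (suc n) (ℕ.n≢0⇒n>0 (ℕ.≢-nonZero⁻¹ (n !) {{n ℕ.!≢0}})))

  𝑒 : ℝ
  𝑒 .seq = expSum
  𝑒 .cauchy {ε} 0<ε with archimedean (0<½* 0<ε)
  ... | M , hM = N , λ m n m≥ n≥ →
      ∣-∣-< (expSum m) (expSum n) (close m n m≥ n≥) (close n m n≥ m≥)
    where
    open ℚ.≤-Reasoning
    N = suc M
    upper : ∀ m → N ℕ.≤ m → expSum m ℚ.< expSum N ℚ.+ ε
    upper m m≥ = begin-strict
      expSum m                               ≤⟨ p≤p+q _ (0≤1/! m) ⟩
      expSum m ℚ.+ 1/! m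
        ≤⟨ subst (λ i → expSum i ℚ.+ 1/! i ℚ.≤ expSum N ℚ.+ 1/! N) (ℕ.m∸n+n≡m m≥)
             (expSum-tail N (ℕ.s≤s ℕ.z≤n) (m ℕ.∸ N)) ⟩
      expSum N ℚ.+ 1/! N
        ≤⟨ ℚ.+-monoʳ-≤ (expSum N)
             (ℚ.≤-trans (1/n-antimono {{_}} {{N ℕ.!≢0}} (n≤n! N)) (hM M ℕ.≤-refl)) ⟩
      expSum N ℚ.+ ½ ℚ.* ε                   <⟨ ℚ.+-monoʳ-< (expSum N) (½*< 0<ε) ⟩
      expSum N ℚ.+ ε                         ∎
    close : ∀ m n → N ℕ.≤ m → N ℕ.≤ n → expSum m ℚ.< expSum n ℚ.+ ε
    close m n m≥ n≥ = ℚ.<-≤-trans (upper m m≥) (ℚ.+-monoˡ-≤ ε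
      (subst (λ i → expSum N ℚ.≤ expSum i) (ℕ.m∸n+n≡m n≥) (expSum-increasing N (n ℕ.∸ N))))

  1≤expSum : ∀ n → 1ℚ ℚ.≤ expSum n
  1≤expSum n = subst (λ i → 1ℚ ℚ.≤ expSum i) (ℕ.+-identityʳ n) (expSum-increasing 0 n)

  1≤∜𝑒 : ∀ n → 1ℚ ℚ.≤ seq (∜ 𝑒) n
  1≤∜𝑒 n = subst (ℚ._≤ root⁴ℚ n q) (n/n≡1 (suc n))
    (root⁴ℚ-maximal n q (suc n) (subst (λ p → p ⁴ ℚ.≤ q ℚ.⊔ 0ℚ) (sym (n/n≡1 (suc n)))
      (ℚ.≤-trans (1≤expSum n) (ℚ.p≤p⊔q q 0ℚ))))
    where q = expSum n

  0<∜𝑒 : 0ℝ < ∜ 𝑒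
  0<∜𝑒 = 1ℚ , ℚ.positive⁻¹ 1ℚ , 0 , λ n _ →
    ≤-by (ℚ.+-identityˡ 1ℚ) (1≤∜𝑒 n)

robustness : ℝ
robustness = fromℚ ½ * (1ℝ - recip (∜ 𝑒) 0<∜𝑒)

------------------------------------------------------------------------
-- Set functions

Monotone : ∀ {n} → (Subset n → ℝ) → Set
Monotone f = ∀ {X Y} → X ⊆ Y → f X ≤ f Y

Submodular : ∀ {n} → (Subset n → ℝ) → Set
Submodular f = ∀ X Y → f (X ∪ Y) + f (X ∩ Y) ≤ f X + f Y

------------------------------------------------------------------------
-- Knapsack policies

-- For q ≥ 1 this says K = ⌈log₂ q⌉, since  log₂ q ≤ j  means  q ≤ 2ʲ.
IsCeilLog₂ : ℚ → ℕ → Set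
IsCeilLog₂ q K = q ℚ.≤ pow K × (∀ j → q ℚ.≤ pow j → K ℕ.≤ j)
  where
  pow : ℕ → ℚ
  pow j = ℤ.+ (2 ℕ.^ j) ℚ./ 1

minimum : ∀ {m} → (Fin (suc m) → ℕ) → ℕ
minimum s = Vec.foldr₁ ℕ._⊓_ (Vec.tabulate s)

minimum-nonZero : ∀ {m} (s : Fin (suc m) → ℕ) → (∀ i → NonZero (s i)) → NonZero (minimum s)
minimum-nonZero {zero}  s s>0 = s>0 Fin.zero
minimum-nonZero {suc m} s s>0 = ⊓-nonZero (s Fin.zero) (minimum (s ∘ Fin.suc))
  (s>0 Fin.zero) (minimum-nonZero (s ∘ Fin.suc) (s>0 ∘ Fin.suc))
  where
  ⊓-nonZero : ∀ a b → NonZero a → NonZero b → NonZero (a ℕ.⊓ b)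
  ⊓-nonZero (suc a) (suc b) _ _ = _

-- xs lists the elements of X in some order, without repetition.
Enumerates : ∀ {n} → List (Fin n) → Subset n → Set
Enumerates xs X = Unique xs × (∀ i → (i List.∈ xs) ⇔ (i ∈ X))

module Policies {m : ℕ} (s : Fin (suc m) → ℕ) (s>0 : ∀ i → NonZero (s i))
                (f : Subset (suc m) → ℝ) where

  private
    Item  = Fin (suc m)
    Items = Subset (suc m)

  size : Items → ℕ
  size X = Vec.sum (Vec.tabulate λ i → if Vec.lookup X i then s i else 0)

  Fits : ℝ → Items → Set
  Fits C X = fromℕ (size X) ≤ C

  IsOPT : ℝ → Items → Set
  IsOPT C X = Fits C X × (∀ Y → Fits C Y → f Y ≤ f X)

  -- Run C X Π Y: processing Π with current set X ends with the set Y.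
  -- A relation, because comparing a natural number with a real is undecidable.
  data Run (C : ℝ) : Items → List Item → Items → Set where
    done    : ∀ {X} → Run C X [] X
    add     : ∀ {X i Π Y} → fromℕ (size X ℕ.+ s i) ≤ C →
              Run C (X ∪ ⁅ i ⁆) Π Y → Run C X (i ∷ Π) Y
    discard : ∀ {X i Π Y} → ¬ (fromℕ (size X ℕ.+ s i) ≤ C) →
              Run C X Π Y → Run C X (i ∷ Π) Y

  Output : ℝ → List Item → Items → Set
  Output C Π Y = Run C ⊥ Π Y

  density : Items → Item → ℝ
  density X i = (f (X ∪ ⁅ i ⁆) - f X) * fromℚ ((ℤ.+ 1 ℚ./ s i) {{s>0 i}})

  IsDensest : Items → Items → Item → Set
  IsDensest X R i = i ∈ R × (∀ j → j ∈ R → density X j ≤ density X i)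

  -- Greedy c X R Y: with current set X and remaining items R, some way of
  -- breaking the ties makes the procedure end with the set Y.
  data Greedy (c : ℕ) : Items → Items → Items → Set where
    done : ∀ {X R} → Empty R → Greedy c X R X
    take : ∀ {X R i Y} → IsDensest X R i → size X ℕ.+ s i ℕ.≤ c →
           Greedy c (X ∪ ⁅ i ⁆) (R Subset.- i) Y → Greedy c X R Y
    skip : ∀ {X R i Y} → IsDensest X R i → ¬ (size X ℕ.+ s i ℕ.≤ c) →
           Greedy c X (R Subset.- i) Y → Greedy c X R Y

  𝒫¹ : ℕ → Items → Set
  𝒫¹ c Y = Greedy c ⊥ ⊤ Y

  s-min : ℕ
  s-min = minimum s

  record IsΠ¹ (Π : List Item) : Set where
    field
      K            : ℕ
      K-ceilLog    : IsCeilLog₂ ((ℤ.+ size ⊤ ℚ./ s-min) {{minimum-nonZero s s>0}}) K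
      Y            : ℕ → Items
      Y-greedy     : ∀ k → k ℕ.≤ K → 𝒫¹ (2 ℕ.^ k ℕ.* s-min) (Y k)
      block        : ℕ → List Item
      block-lists  : ∀ k → k ℕ.≤ K → Enumerates (block k) (Y k ─ ⋃ (applyUpTo Y k))
      Π-concat     : Π ≡ concat (applyUpTo block (suc K))

  record IsΠ² (Π : List Item) : Set where
    field
      all-items  : Enumerates Π ⊤
      decreasing : AllPairs (λ i j → f ⁅ j ⁆ ≤ f ⁅ i ⁆) Π

{-# OPTIONS --safe #-}
module Submission where

-- Let k ≤ K be largest such that 2ᵏ⁺¹ s-min ≤ C; without such a k, OPT is at most one item, and
-- Π² suffices. The blocks Y⁽⁰⁾, …, Y⁽ᵏ⁾ weigh less than 2ᵏ⁺¹ s-min together, so Π¹ packs all of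
-- Y⁽ᵏ⁾, the greedy set for c = 2ᵏ s-min, while OPT weighs at most 4c. A greedy step of size a
-- multiplies the gap f(OPT) - f(X) by at most 1 - a/(4c) ≤ exp(-a/(4c)). When the first item i of
-- OPT overflows, size(X ∪ {i}) > c, so f(X ∪ {i}) ≥ (1 - e^{-1/4}) f(OPT); here f(X) is covered by
-- Π¹, and f({i}) by Π², whose first packed item is at least as valuable as i. To stay within ℚ, exp
-- is replaced by its Taylor polynomials Eₙ, which satisfy Eₙ(y + x)(1 - x) ≤ Eₙ(y). The case
-- distinctions on C are undecidable, but inequalities between reals are ¬¬-stable.

open import Defs
open RationalLemmas
open import Data.Bool.Base using (if_then_else_)
open import Data.Empty using (⊥-elim)
open import Data.Fin.Base using (Fin; zero; suc)
import Data.Fin.Properties as Fin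
open import Data.Fin.Subset as Subset
  using (Subset; _∈_; _∉_; _⊆_; _∪_; _∩_; _─_; ⁅_⁆; ⋃; ⊤; ⊥; inside; outside)
open import Data.Fin.Subset.Properties
open import Data.Integer.Base using (+_)
import Data.Integer.Base as ℤ
import Data.Integer.Properties as ℤ
open import Data.List.Base using (List; []; _∷_; _++_; concat; applyUpTo; map)
import Data.List.Membership.Propositional as List
open import Data.List.Membership.Propositional.Properties using (∈-concat⁺′; ∈-applyUpTo⁺)
open import Data.List.Properties using (concat-++; map-++)
open import Data.List.Relation.Unary.All as All using (All; []; _∷_)
open import Data.List.Relation.Unary.AllPairs using (AllPairs; []; _∷_)
open import Data.List.Relation.Unary.Any using (here; there)
open import Data.List.Relation.Unary.Unique.Propositional using (Unique)
open import Data.Nat.Base as ℕ using (ℕ; zero; suc; NonZero; _!)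
open import Data.Nat.Induction using (<-rec)
open import Data.Nat.ListAction using (sum)
open import Data.Nat.ListAction.Properties using (sum-++)
import Data.Nat.Properties as ℕ
open import Data.Product using (∃-syntax; _×_; _,_; proj₁; proj₂)
open import Data.Rational.Base as ℚ using (ℚ; 0ℚ; 1ℚ; ½; _/_)
import Data.Rational.Properties as ℚ
open import Data.Rational.Solver using (module +-*-Solver)
import Data.Rational.Unnormalised.Base as ℚᵘ
import Data.Rational.Unnormalised.Properties as ℚᵘ
open import Data.Sum.Base using (_⊎_; inj₁; inj₂; [_,_]′)
open import Data.Vec.Base as Vec using ([]; _∷_)
open import Function.Base using (_∘_; id)
open import Function.Bundles using (Equivalence)
open import Relation.Binary.PropositionalEquality
open import Relation.Nullary using (¬_; yes; no)
open +-*-Solver using (solve; _:=_; _:+_; _:*_; _:-_; con)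

-- Rational arithmetic and the exponential series

module _ where

  open ℚ.≤-Reasoning

  0≤1 : 0ℚ ℚ.≤ 1ℚ
  0≤1 = ℚ.nonNegative⁻¹ 1ℚ

  0≤p-q⇒q≤p : ∀ {p q} → 0ℚ ℚ.≤ p ℚ.- q → q ℚ.≤ p
  0≤p-q⇒q≤p {p} {q} h = subst₂ ℚ._≤_ (ℚ.+-identityʳ q)
    (solve 2 (λ p q → q :+ (p :- q) := p) refl p q) (ℚ.+-monoʳ-≤ q h)

  q≤p⇒0≤p-q : ∀ {p q} → q ℚ.≤ p → 0ℚ ℚ.≤ p ℚ.- q
  q≤p⇒0≤p-q {p} {q} h = subst (ℚ._≤ p ℚ.- q) (ℚ.+-inverseʳ q) (ℚ.+-monoˡ-≤ (ℚ.- q) h)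

  ¼ : ℚ
  ¼ = ℤ.+ 1 ℚ./ 4

  -- Opaque, since fractions with a variable numerator or denominator unfold to huge terms.
  opaque
    ι : ℕ → ℚ
    ι n = ℤ.+ n ℚ./ 1

    ι-suc : ∀ n → ι (suc n) ≡ ι n ℚ.+ 1ℚ
    ι-suc n = [1+k]/d n 1

    ι-0 : ι 0 ≡ 0ℚ
    ι-0 = refl

    ι-1 : ι 1 ≡ 1ℚ
    ι-1 = refl

    ¼*ι4 : ¼ ℚ.* ι 4 ≡ 1ℚ
    ¼*ι4 = refl

    ι-mono-≤ : ∀ {a b} → a ℕ.≤ b → ι a ℚ.≤ ι b
    ι-mono-≤ = /1-mono-≤

    ι-* : ∀ a b → ι (a ℕ.* b) ≡ ι a ℚ.* ι b
    ι-* a b = ℚ.toℚᵘ-injective (ℚᵘ.≃-trans (toℚᵘ-/ (ℤ.+ (a ℕ.* b)) 1)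
      (ℚᵘ.≃-sym (ℚᵘ.≃-trans (ℚ.toℚᵘ-homo-* (ι a) (ι b))
        (ℚᵘ.≃-trans (ℚᵘ.*-cong (toℚᵘ-/ (ℤ.+ a) 1) (toℚᵘ-/ (ℤ.+ b) 1))
          (ℚᵘ.*≡* (cong (ℤ._* ℤ.+ 1) (sym (ℤ.pos-* a b))))))))

    ι-+ : ∀ a b → ι (a ℕ.+ b) ≡ ι a ℚ.+ ι b
    ι-+ zero    b = sym (ℚ.+-identityˡ (ι b))
    ι-+ (suc a) b = begin-equality
      ι (suc (a ℕ.+ b))        ≡⟨ ι-suc (a ℕ.+ b) ⟩
      ι (a ℕ.+ b) ℚ.+ 1ℚ       ≡⟨ cong (ℚ._+ 1ℚ) (ι-+ a b) ⟩
      ι a ℚ.+ ι b ℚ.+ 1ℚ       ≡⟨ solve 3 (λ a b c → a :+ b :+ c := a :+ c :+ b) refl (ι a) (ι b) 1ℚ ⟩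
      ι a ℚ.+ 1ℚ ℚ.+ ι b       ≡⟨ cong (ℚ._+ ι b) (ι-suc a) ⟨
      ι (suc a) ℚ.+ ι b        ∎

    1/ι : ∀ n .{{_ : NonZero n}} → ℚ
    1/ι n = ℤ.+ 1 ℚ./ n

    0≤1/ι : ∀ n .{{_ : NonZero n}} → 0ℚ ℚ.≤ 1/ι n
    0≤1/ι n = 0≤n/d 1 n

    ι-inverse : ∀ n .{{_ : NonZero n}} → ι n ℚ.* 1/ι n ≡ 1ℚ
    ι-inverse n@(suc _) = ℚ.toℚᵘ-injective (ℚᵘ.≃-trans (ℚ.toℚᵘ-homo-* (ι n) (1/ι n))
      (ℚᵘ.≃-trans (ℚᵘ.*-cong (toℚᵘ-/ (ℤ.+ n) 1) (toℚᵘ-/ (ℤ.+ 1) n))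
        (ℚᵘ.*≡* (cong ℤ.+_ (reassociate n)))))
      where
      reassociate : ∀ n → n ℕ.* 1 ℕ.* 1 ≡ 1 ℕ.* (1 ℕ.* n)
      reassociate n = trans (ℕ.*-comm (n ℕ.* 1) 1) (cong (1 ℕ.*_) (ℕ.*-comm n 1))

    0≤ι : ∀ n → 0ℚ ℚ.≤ ι n
    0≤ι n = 0≤n/d n 1

    n/d≤k⇒n≤k*d : ∀ n d k .{{_ : NonZero d}} → ℤ.+ n ℚ./ d ℚ.≤ ℤ.+ k ℚ./ 1 → n ℕ.≤ k ℕ.* d
    n/d≤k⇒n≤k*d n d@(suc _) k le = ℤ.drop‿+≤+ (subst₂ ℤ._≤_ (ℤ.*-identityʳ (ℤ.+ n)) (sym (ℤ.pos-* k d))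
      (ℚᵘ.drop-*≤* (ℚᵘ.≤-respʳ-≃ (toℚᵘ-/ (ℤ.+ k) 1)
        (ℚᵘ.≤-respˡ-≃ (toℚᵘ-/ (ℤ.+ n) d) (ℚ.toℚᵘ-mono-≤ le)))))

    1/!-suc : ∀ k → ι (suc k) ℚ.* 1/! (suc k) ≡ 1/! k
    1/!-suc k = begin-equality
      n ℚ.* v                    ≡⟨ ℚ.*-identityʳ _ ⟨
      n ℚ.* v ℚ.* 1ℚ             ≡⟨ cong (n ℚ.* v ℚ.*_) (ι-inverse (k !) {{k ℕ.!≢0}}) ⟨
      n ℚ.* v ℚ.* (ι (k !) ℚ.* w)
        ≡⟨ solve 4 (λ n v a w → n :* v :* (a :* w) := (n :* a) :* v :* w) refl n v (ι (k !)) w ⟩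
      n ℚ.* ι (k !) ℚ.* v ℚ.* w  ≡⟨ cong (λ p → p ℚ.* v ℚ.* w) (ι-* (suc k) (k !)) ⟨
      ι (suc k !) ℚ.* v ℚ.* w    ≡⟨ cong (ℚ._* w) (ι-inverse (suc k !) {{suc k ℕ.!≢0}}) ⟩
      1ℚ ℚ.* w                   ≡⟨ ℚ.*-identityˡ w ⟩
      w                          ∎
      where
      n v w : ℚ
      n = ι (suc k) ; v = 1/! (suc k) ; w = 1/! k

  -- Powers and Taylor polynomials of exp.

  infixr 8 _^_
  _^_ : ℚ → ℕ → ℚ
  t ^ zero  = 1ℚ
  t ^ suc k = t ℚ.* t ^ k

  0≤^ : ∀ {t} → 0ℚ ℚ.≤ t → ∀ k → 0ℚ ℚ.≤ t ^ k
  0≤^ 0≤t zero    = 0≤1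
  0≤^ 0≤t (suc k) = 0≤* 0≤t (0≤^ 0≤t k)

  1≤^ : ∀ {t} → 1ℚ ℚ.≤ t → ∀ k → 1ℚ ℚ.≤ t ^ k
  1≤^ 1≤t zero    = ℚ.≤-refl
  1≤^ 1≤t (suc k) = ≤-by (sym (ℚ.*-identityˡ 1ℚ)) (*-mono-≤ 0≤1 1≤t 0≤1 (1≤^ 1≤t k))

  -- Convexity of the power: the tangent at `y + x` runs below the graph. In the induction step the
  -- only loss is the nonnegative term `n x² (y + x)^k`.
  ^-tangent : ∀ {y x} → 0ℚ ℚ.≤ y → 0ℚ ℚ.≤ x → ∀ k →
    (y ℚ.+ x) ^ suc k ℚ.≤ y ^ suc k ℚ.+ ι (suc k) ℚ.* (x ℚ.* (y ℚ.+ x) ^ k)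
  ^-tangent {y} {x} 0≤y 0≤x zero = ℚ.≤-reflexive (trans
    (solve 2 (λ y x → (y :+ x) :* con 1ℚ := y :* con 1ℚ :+ con 1ℚ :* (x :* con 1ℚ)) refl y x)
    (cong (λ p → y ^ 1 ℚ.+ p ℚ.* (x ℚ.* 1ℚ)) (sym ι-1)))
  ^-tangent {y} {x} 0≤y 0≤x (suc k) = begin
    z ℚ.* z ^ suc k                      ≡⟨ ℚ.*-distribʳ-+ (z ^ suc k) y x ⟩
    y ℚ.* z ^ suc k ℚ.+ x ℚ.* z ^ suc k
      ≤⟨ ℚ.+-monoˡ-≤ (x ℚ.* z ^ suc k)
           (ℚ.*-monoˡ-≤-nonNeg y {{ℚ.nonNegative 0≤y}} (^-tangent 0≤y 0≤x k)) ⟩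
    y ℚ.* (y ^ suc k ℚ.+ n ℚ.* (x ℚ.* z ^ k)) ℚ.+ x ℚ.* z ^ suc k
      ≤⟨ p≤p+q _ (0≤* (0≤* (0≤ι (suc k)) (0≤* 0≤x 0≤x)) (0≤^ (0≤+ 0≤y 0≤x) k)) ⟩
    y ℚ.* (y ^ suc k ℚ.+ n ℚ.* (x ℚ.* z ^ k)) ℚ.+ x ℚ.* z ^ suc k ℚ.+ n ℚ.* (x ℚ.* x) ℚ.* z ^ k
      ≡⟨ solve 5 (λ y x n Y Z → y :* (Y :+ n :* (x :* Z)) :+ x :* ((y :+ x) :* Z) :+ n :* (x :* x) :* Z
                     := y :* Y :+ (n :+ con 1ℚ) :* (x :* ((y :+ x) :* Z)))
               refl y x n (y ^ suc k) (z ^ k) ⟩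
    y ^ suc (suc k) ℚ.+ (n ℚ.+ 1ℚ) ℚ.* (x ℚ.* z ^ suc k)
      ≡⟨ cong (λ p → y ^ suc (suc k) ℚ.+ p ℚ.* (x ℚ.* z ^ suc k)) (ι-suc (suc k)) ⟨
    y ^ suc (suc k) ℚ.+ ι (suc (suc k)) ℚ.* (x ℚ.* z ^ suc k) ∎
    where
    z = y ℚ.+ x ; n = ι (suc k)

  expTaylor : ℕ → ℚ → ℚ
  expTaylor zero    t = 1ℚ
  expTaylor (suc n) t = expTaylor n t ℚ.+ t ^ suc n ℚ.* 1/! (suc n)

  1≤expTaylor : ∀ n {t} → 0ℚ ℚ.≤ t → 1ℚ ℚ.≤ expTaylor n t
  1≤expTaylor zero    0≤t = ℚ.≤-refl
  1≤expTaylor (suc n) 0≤t =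
    ℚ.≤-trans (1≤expTaylor n 0≤t) (p≤p+q _ (0≤* (0≤^ 0≤t (suc n)) (0≤1/! (suc n))))

  expTaylor-0 : ∀ n → expTaylor n 0ℚ ≡ 1ℚ
  expTaylor-0 zero    = refl
  expTaylor-0 (suc n) = begin-equality
    expTaylor n 0ℚ ℚ.+ 0ℚ ℚ.* 0ℚ ^ n ℚ.* 1/! (suc n)
      ≡⟨ solve 3 (λ e p v → e :+ con 0ℚ :* p :* v := e) refl (expTaylor n 0ℚ) (0ℚ ^ n) (1/! (suc n)) ⟩
    expTaylor n 0ℚ  ≡⟨ expTaylor-0 n ⟩
    1ℚ ∎

  expSum≤expTaylor : ∀ n {t} → 1ℚ ℚ.≤ t → expSum n ℚ.≤ expTaylor n t
  expSum≤expTaylor zero    1≤t = ℚ.≤-refl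
  expSum≤expTaylor (suc n) 1≤t = ℚ.+-mono-≤ (expSum≤expTaylor n 1≤t)
    (≤-by (sym (ℚ.*-identityˡ (1/! (suc n))))
      (*-mono-≤ 0≤1 (1≤^ 1≤t (suc n)) (0≤1/! (suc n)) ℚ.≤-refl))

  -- The Taylor polynomials have derivative at most themselves, as exp does.
  expTaylor-tangent : ∀ n {y x} → 0ℚ ℚ.≤ y → 0ℚ ℚ.≤ x →
    expTaylor n (y ℚ.+ x) ℚ.≤ expTaylor n y ℚ.+ x ℚ.* expTaylor n (y ℚ.+ x)
  expTaylor-tangent zero {y} {x} 0≤y 0≤x = p≤p+q 1ℚ (0≤* 0≤x 0≤1)
  expTaylor-tangent (suc n) {y} {x} 0≤y 0≤x = begin
    expTaylor (suc n) z                            ≤⟨ previous n ⟩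
    expTaylor (suc n) y ℚ.+ x ℚ.* expTaylor n z
      ≤⟨ ℚ.+-monoʳ-≤ (expTaylor (suc n) y) (ℚ.*-monoˡ-≤-nonNeg x {{ℚ.nonNegative 0≤x}}
           (p≤p+q _ (0≤* (0≤^ 0≤z (suc n)) (0≤1/! (suc n))))) ⟩
    expTaylor (suc n) y ℚ.+ x ℚ.* expTaylor (suc n) z ∎
    where
    z = y ℚ.+ x
    0≤z = 0≤+ 0≤y 0≤x
    term : ∀ k → z ^ suc k ℚ.* 1/! (suc k) ℚ.≤ y ^ suc k ℚ.* 1/! (suc k) ℚ.+ x ℚ.* (z ^ k ℚ.* 1/! k)
    term k = begin
      z ^ suc k ℚ.* v
        ≤⟨ ℚ.*-monoʳ-≤-nonNeg v {{ℚ.nonNegative (0≤1/! (suc k))}} (^-tangent 0≤y 0≤x k) ⟩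
      (y ^ suc k ℚ.+ ι (suc k) ℚ.* (x ℚ.* z ^ k)) ℚ.* v
        ≡⟨ solve 5 (λ Y m x Z v → (Y :+ m :* (x :* Z)) :* v := Y :* v :+ x :* (Z :* (m :* v)))
                 refl (y ^ suc k) (ι (suc k)) x (z ^ k) v ⟩
      y ^ suc k ℚ.* v ℚ.+ x ℚ.* (z ^ k ℚ.* (ι (suc k) ℚ.* v))
        ≡⟨ cong (λ p → y ^ suc k ℚ.* v ℚ.+ x ℚ.* (z ^ k ℚ.* p)) (1/!-suc k) ⟩
      y ^ suc k ℚ.* v ℚ.+ x ℚ.* (z ^ k ℚ.* 1/! k) ∎
      where v = 1/! (suc k)
    -- The derivative of the polynomial of degree `n + 1` is the one of degree `n`; the bounds
    -- `term k` therefore sum up with the degree on the right lowered by one.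
    previous : ∀ n → expTaylor (suc n) z ℚ.≤ expTaylor (suc n) y ℚ.+ x ℚ.* expTaylor n z
    previous zero = begin
      1ℚ ℚ.+ z ^ 1 ℚ.* 1/! 1        ≤⟨ ℚ.+-monoʳ-≤ 1ℚ (term 0) ⟩
      1ℚ ℚ.+ (y ^ 1 ℚ.* 1/! 1 ℚ.+ x ℚ.* 1ℚ)  ≡⟨ ℚ.+-assoc 1ℚ (y ^ 1 ℚ.* 1/! 1) (x ℚ.* 1ℚ) ⟨
      1ℚ ℚ.+ y ^ 1 ℚ.* 1/! 1 ℚ.+ x ℚ.* 1ℚ ∎
    previous (suc n) = begin
      expTaylor (suc n) z ℚ.+ z ^ suc (suc n) ℚ.* 1/! (suc (suc n))
        ≤⟨ ℚ.+-mono-≤ (previous n) (term (suc n)) ⟩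
      expTaylor (suc n) y ℚ.+ x ℚ.* expTaylor n z ℚ.+ (b ℚ.+ x ℚ.* c)
        ≡⟨ solve 5 (λ e x d b c → e :+ x :* d :+ (b :+ x :* c) := e :+ b :+ x :* (d :+ c))
                 refl (expTaylor (suc n) y) x (expTaylor n z) b c ⟩
      expTaylor (suc (suc n)) y ℚ.+ x ℚ.* expTaylor (suc n) z ∎
      where
      b = y ^ suc (suc n) ℚ.* 1/! (suc (suc n))
      c = z ^ suc n ℚ.* 1/! (suc n)

  expTaylor-decay : ∀ n {y x} → 0ℚ ℚ.≤ y → 0ℚ ℚ.≤ x →
    expTaylor n (y ℚ.+ x) ℚ.* (1ℚ ℚ.- x) ℚ.≤ expTaylor n y
  expTaylor-decay n {y} {x} 0≤y 0≤x = 0≤p-q⇒q≤p (subst (0ℚ ℚ.≤_)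
    (solve 3 (λ a b x → a :+ x :* b :- b := a :- b :* (con 1ℚ :- x)) refl
      (expTaylor n y) (expTaylor n (y ℚ.+ x)) x)
    (q≤p⇒0≤p-q (expTaylor-tangent n 0≤y 0≤x)))

  -- Discount factors enter as fourth powers, so that they can be compared with e instead of its
  -- fourth root. A fourth power pays for four steps of length `x`; `x ≤ 1` keeps `1 - x`
  -- nonnegative, so that inequalities may be multiplied by it.
  expTaylor-decay⁴ : ∀ n {y x} → 0ℚ ℚ.≤ y → 0ℚ ℚ.≤ x → x ℚ.≤ 1ℚ →
    expTaylor n (y ℚ.+ x ℚ.+ x ℚ.+ x ℚ.+ x) ℚ.* (1ℚ ℚ.- x) ⁴ ℚ.≤ expTaylor n y
  expTaylor-decay⁴ n {y} {x} 0≤y 0≤x x≤1 = begin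
    e ℚ.* w ⁴                       ≡⟨ solve 2 (λ e w → e :* ((w :* w) :* (w :* w))
                                         := e :* w :* w :* w :* w) refl e w ⟩
    e ℚ.* w ℚ.* w ℚ.* w ℚ.* w       ≤⟨ *w (*w (*w (expTaylor-decay n 0≤y₃ 0≤x))) ⟩
    expTaylor n y₃ ℚ.* w ℚ.* w ℚ.* w ≤⟨ *w (*w (expTaylor-decay n 0≤y₂ 0≤x)) ⟩
    expTaylor n y₂ ℚ.* w ℚ.* w      ≤⟨ *w (expTaylor-decay n 0≤y₁ 0≤x) ⟩
    expTaylor n y₁ ℚ.* w            ≤⟨ expTaylor-decay n 0≤y 0≤x ⟩
    expTaylor n y                   ∎
    where
    w = 1ℚ ℚ.- x
    y₁ = y ℚ.+ x ; y₂ = y₁ ℚ.+ x ; y₃ = y₂ ℚ.+ x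
    e = expTaylor n (y₃ ℚ.+ x)
    0≤y₁ = 0≤+ 0≤y 0≤x ; 0≤y₂ = 0≤+ 0≤y₁ 0≤x ; 0≤y₃ = 0≤+ 0≤y₂ 0≤x
    *w : ∀ {p q} → p ℚ.≤ q → p ℚ.* w ℚ.≤ q ℚ.* w
    *w = ℚ.*-monoʳ-≤-nonNeg w {{ℚ.nonNegative (q≤p⇒0≤p-q x≤1)}}

  ⁴-≤1 : ∀ {p} → p ⁴ ℚ.≤ 1ℚ → p ℚ.≤ 1ℚ
  ⁴-≤1 {p} h = ℚ.≮⇒≥ λ 1<p → ℚ.<-irrefl refl (ℚ.<-≤-trans 1<p (ℚ.≤-trans (p≤p⁴ (ℚ.<⇒≤ 1<p)) h))

  -- Bounds on the reciprocal of the fourth root of e.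

  ∜𝑒ₙ : ℕ → ℚ
  ∜𝑒ₙ n = seq (∜ 𝑒) n

  ∜𝑒-lower : ∀ n → ∜𝑒ₙ n ⁴ ℚ.≤ expSum n
  ∜𝑒-lower n = subst (∜𝑒ₙ n ⁴ ℚ.≤_) (ℚ.p≥q⇒p⊔q≡p (ℚ.≤-trans 0≤1 (1≤expSum n)))
    (root⁴ℚ-lower n (expSum n))

  0<∜𝑒ₙ : ∀ n → 0ℚ ℚ.< ∜𝑒ₙ n
  0<∜𝑒ₙ n = ℚ.<-≤-trans (ℚ.positive⁻¹ 1ℚ) (1≤∜𝑒 n)

  0≤recipℚ : ∀ {q} → 0ℚ ℚ.< q → 0ℚ ℚ.≤ recipℚ q
  0≤recipℚ {q} 0<q = ℚ.*-cancelʳ-≤-pos q {{ℚ.positive 0<q}}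
    (subst₂ ℚ._≤_ (sym (ℚ.*-zeroˡ q)) (sym (recipℚ-inverse 0<q)) 0≤1)

  ≤recipℚ : ∀ {q P} → 0ℚ ℚ.< q → q ℚ.* P ℚ.≤ 1ℚ → P ℚ.≤ recipℚ q
  ≤recipℚ {q} {P} 0<q h = ℚ.*-cancelʳ-≤-pos q {{ℚ.positive 0<q}}
    (subst₂ ℚ._≤_ (ℚ.*-comm q P) (sym (recipℚ-inverse 0<q)) h)

  recipℚ≤ : ∀ {q P} → 0ℚ ℚ.< q → 1ℚ ℚ.≤ q ℚ.* P → recipℚ q ℚ.≤ P
  recipℚ≤ {q} {P} 0<q h = ℚ.*-cancelʳ-≤-pos q {{ℚ.positive 0<q}}
    (subst₂ ℚ._≤_ (sym (recipℚ-inverse 0<q)) (ℚ.*-comm q P) h)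

  opaque
    1/∜𝑒 : ℝ
    1/∜𝑒 = recip (∜ 𝑒) 0<∜𝑒

    robustness-seq : ∀ n → seq robustness n ≡ ½ ℚ.* (1ℚ ℚ.- seq 1/∜𝑒 n)
    robustness-seq n = refl

    1/∜𝑒-seq : ∀ n → seq 1/∜𝑒 n ≡ recipℚ (∜𝑒ₙ n)
    1/∜𝑒-seq n = refl

  0≤1/∜𝑒 : ∀ n → 0ℚ ℚ.≤ seq 1/∜𝑒 n
  0≤1/∜𝑒 n = subst (0ℚ ℚ.≤_) (sym (1/∜𝑒-seq n)) (0≤recipℚ (0<∜𝑒ₙ n))

  1/∜𝑒-upper : ∀ n → seq 1/∜𝑒 n ℚ.≤ 1ℚ
  1/∜𝑒-upper n = ≤-by (1/∜𝑒-seq n) (recipℚ≤ (0<∜𝑒ₙ n) (subst (1ℚ ℚ.≤_) (sym (ℚ.*-identityʳ _)) (1≤∜𝑒 n)))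

  -- The rational root at index `n` is rounded down, so its fourth power is at most `expSum n`.
  -- Hence the estimate holds at each index without an error term.
  ≤1/∜𝑒 : ∀ {P} → 0ℚ ℚ.≤ P → ∀ n → expSum n ℚ.* P ⁴ ℚ.≤ 1ℚ → P ℚ.≤ seq 1/∜𝑒 n
  ≤1/∜𝑒 {P} 0≤P n h = subst (P ℚ.≤_) (sym (1/∜𝑒-seq n)) (≤recipℚ (0<∜𝑒ₙ n) (⁴-≤1 (begin
    (∜𝑒ₙ n ℚ.* P) ⁴     ≡⟨ solve 2 (λ r p → ((r :* p) :* (r :* p)) :* ((r :* p) :* (r :* p))
                              := ((r :* r) :* (r :* r)) :* ((p :* p) :* (p :* p))) refl (∜𝑒ₙ n) P ⟩
    ∜𝑒ₙ n ⁴ ℚ.* P ⁴     ≤⟨ ℚ.*-monoʳ-≤-nonNeg (P ⁴) {{ℚ.nonNegative (0≤* (0≤* 0≤P 0≤P) (0≤* 0≤P 0≤P))}}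
                                (∜𝑒-lower n) ⟩
    expSum n ℚ.* P ⁴    ≤⟨ h ⟩
    1ℚ                  ∎)))

  -- (1.2838)⁴ ≤ Σ_{k ≤ 5} 1/k!  and  1/1.2833 ≤ 0.7793
  0·110<robustness : fromℚ (ℤ.+ 110 ℚ./ 1000) < robustness
  0·110<robustness = ε , ℚ.positive⁻¹ ε , suc (suc N₀) , bound
    where
    ε = ℤ.+ 1 ℚ./ 10000
    -- The root at index `n` may fall short of the true root of `expSum n` by up to `1/(n+1)`. At
    -- the indices considered this is at most `1/4001`, and `1.2838 - 1/4001` still exceeds
    -- `1.2833`.
    N₀ = 4000
    bound : ∀ n → suc (suc N₀) ℕ.≤ n → ℤ.+ 110 ℚ./ 1000 ℚ.+ ε ℚ.≤ ½ ℚ.* (1ℚ ℚ.- recipℚ (∜𝑒ₙ n))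
    bound n n≥ = begin
      ℤ.+ 110 ℚ./ 1000 ℚ.+ ε         ≤⟨ ℚ.≤ᵇ⇒≤ _ ⟩
      ½ ℚ.* (1ℚ ℚ.- b)               ≤⟨ ℚ.*-monoˡ-≤-nonNeg ½ (ℚ.+-monoʳ-≤ 1ℚ (ℚ.neg-antimono-≤ rec≤)) ⟩
      ½ ℚ.* (1ℚ ℚ.- recipℚ (∜𝑒ₙ n))      ∎
      where
      a b η r : ℚ
      a = ℤ.+ 12838 ℚ./ 10000
      b = ℤ.+ 7793 ℚ./ 10000
      η = ℤ.+ 1 ℚ./ suc n
      r = ∜𝑒ₙ n
      η≤ : η ℚ.≤ ℤ.+ 1 ℚ./ suc N₀
      η≤ = 1/n-antimono (ℕ.≤-trans (ℕ.n≤1+n (suc N₀)) (ℕ.m≤n⇒m≤1+n n≥))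
      5≤n : 5 ℕ.≤ n
      5≤n = ℕ.≤-trans (ℕ.≤ᵇ⇒≤ 5 (suc (suc N₀)) _) n≥
      a<r+η : a ℚ.< r ℚ.+ η
      a<r+η = ℚ.≰⇒> λ r+η≤a → ℚ.<-irrefl refl (begin-strict
        a ⁴                 ≤⟨ ℚ.≤ᵇ⇒≤ _ ⟩
        expSum 5            ≤⟨ subst (λ i → expSum 5 ℚ.≤ expSum i) (ℕ.m∸n+n≡m 5≤n) (expSum-increasing 5 (n ℕ.∸ 5)) ⟩
        expSum n            ≤⟨ ℚ.p≤p⊔q (expSum n) 0ℚ ⟩
        expSum n ℚ.⊔ 0ℚ     <⟨ root⁴ℚ-upper n (expSum n) ⟩
        (r ℚ.+ η) ⁴         ≤⟨ ⁴-mono-≤ (0≤+ (ℚ.<⇒≤ (0<∜𝑒ₙ n)) (0≤n/d 1 (suc n))) r+η≤a ⟩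
        a ⁴                 ∎)
      a-η₀≤r : a ℚ.- ℤ.+ 1 ℚ./ suc N₀ ℚ.≤ r
      a-η₀≤r = begin
        a ℚ.- ℤ.+ 1 ℚ./ suc N₀   ≤⟨ ℚ.+-mono-≤ (ℚ.<⇒≤ a<r+η) (ℚ.neg-antimono-≤ η≤) ⟩
        r ℚ.+ η ℚ.- η            ≡⟨ solve 2 (λ r η → r :+ η :- η := r) refl r η ⟩
        r                        ∎
      rec≤ : recipℚ (∜𝑒ₙ n) ℚ.≤ b
      rec≤ = recipℚ≤ (0<∜𝑒ₙ n) (begin
        1ℚ                                  ≤⟨ ℚ.≤ᵇ⇒≤ _ ⟩
        (a ℚ.- ℤ.+ 1 ℚ./ suc N₀) ℚ.* b      ≤⟨ ℚ.*-monoʳ-≤-nonNeg b a-η₀≤r ⟩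
        r ℚ.* b                             ∎)

-- Order on the reals

-- A record, so that x can be inferred from a proof.
record Nonneg (x : ℝ) : Set where
  constructor nonneg
  field 0≤ : 0ℝ ≤ x

-- The criterion 0 ≤ z, z = y - x (checked termwise) reduces every inequality
-- between reals to an identity between rationals.
nonneg⇒≤ : ∀ {z} x y → Nonneg z → (∀ n → seq z n ≡ seq y n ℚ.- seq x n) → x ≤ y
nonneg⇒≤ {z} x y (nonneg 0≤z) z≡y-x {ε} 0<ε with 0≤z 0<ε
... | N , h = N , λ n n≥ → subst₂ ℚ._≤_
  (ℚ.+-identityʳ (seq x n))
  (trans (cong (λ p → seq x n ℚ.+ (p ℚ.+ ε)) (z≡y-x n))
    (solve 3 (λ x y e → x :+ (y :- x :+ e) := y :+ e) refl (seq x n) (seq y n) ε))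
  (ℚ.+-monoʳ-≤ (seq x n) (h n n≥))

≤⇒nonneg : ∀ x y → x ≤ y → Nonneg (y - x)
≤⇒nonneg x y x≤y = nonneg λ {ε} 0<ε → let N , h = x≤y 0<ε in N , λ n n≥ →
  subst₂ ℚ._≤_ (ℚ.+-inverseʳ (seq x n))
    (solve 3 (λ x y e → y :+ e :- x := y :- x :+ e) refl (seq x n) (seq y n) ε)
    (ℚ.+-monoˡ-≤ (ℚ.- seq x n) (h n n≥))

nonneg-cong : ∀ {x y} → Nonneg x → (∀ n → seq x n ≡ seq y n) → Nonneg y
nonneg-cong (nonneg 0≤x) x≡y = nonneg λ {ε} 0<ε → let N , h = 0≤x 0<ε in N , λ n n≥ →
  subst (λ p → 0ℚ ℚ.≤ p ℚ.+ ε) (x≡y n) (h n n≥)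

infixl 6 _⊕_
_⊕_ : ∀ {x y} → Nonneg x → Nonneg y → Nonneg (x + y)
_⊕_ {x} {y} (nonneg 0≤x) (nonneg 0≤y) = nonneg λ {ε} 0<ε →
  let M , hx = 0≤x (0<½* 0<ε)
      N , hy = 0≤y (0<½* 0<ε)
  in M ℕ.⊔ N , λ n n≥ → subst (0ℚ ℚ.≤_)
    (trans (solve 3 (λ x y e → x :+ e :+ (y :+ e) := x :+ y :+ (e :+ e)) refl
             (seq x n) (seq y n) (½ ℚ.* ε))
      (cong (seq x n ℚ.+ seq y n ℚ.+_) (½+½ ε)))
    (0≤+ (hx n (ℕ.m⊔n≤o⇒m≤o M N n≥)) (hy n (ℕ.m⊔n≤o⇒n≤o M N n≥)))

-- The terms of `x` are nonnegative only up to a tolerance, which the factor `u` enlarges by at most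
-- `B`; so `x` is taken at tolerance `ε / B`.
nonneg-* : ∀ {x} u B → (∀ n → 0ℚ ℚ.≤ seq u n) → (∀ n → seq u n ℚ.≤ B) → 0ℚ ℚ.< B →
           Nonneg x → Nonneg (u * x)
nonneg-* {x} u B 0≤u u≤B 0<B (nonneg 0≤x) = nonneg λ {ε} 0<ε →
  let 1/B = (ℚ.1/ B) {{ℚ.>-nonZero 0<B}}
      δ   = ε ℚ.* 1/B
      0<δ = 0<* 0<ε (1/-pos 0<B)
      N , h = 0≤x 0<δ
  in N , λ n n≥ → begin
    0ℚ                                                ≤⟨ 0≤* (0≤u n) (h n n≥) ⟩
    seq u n ℚ.* (seq x n ℚ.+ δ)
      ≡⟨ ℚ.*-distribˡ-+ (seq u n) (seq x n) δ ⟩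
    seq u n ℚ.* seq x n ℚ.+ seq u n ℚ.* δ
      ≤⟨ ℚ.+-monoʳ-≤ (seq u n ℚ.* seq x n)
           (ℚ.*-monoʳ-≤-nonNeg δ {{ℚ.nonNegative (ℚ.<⇒≤ 0<δ)}} (u≤B n)) ⟩
    seq u n ℚ.* seq x n ℚ.+ B ℚ.* δ
      ≡⟨ cong (seq u n ℚ.* seq x n ℚ.+_) (trans
           (solve 3 (λ b e i → b :* (e :* i) := e :* (b :* i)) refl B ε 1/B)
           (trans (cong (ε ℚ.*_) (ℚ.*-inverseʳ B {{ℚ.>-nonZero 0<B}})) (ℚ.*-identityʳ ε))) ⟩
    seq u n ℚ.* seq x n ℚ.+ ε                          ∎
  where open ℚ.≤-Reasoning

nonneg-scale : ∀ {x q} → 0ℚ ℚ.≤ q → Nonneg x → Nonneg (fromℚ q * x)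
nonneg-scale {q = q} 0≤q = nonneg-* (fromℚ q) (q ℚ.+ 1ℚ) (λ _ → 0≤q) (λ _ → p≤p+q q 0≤1)
  (ℚ.≤-<-trans 0≤q (p<p+q q (ℚ.positive⁻¹ 1ℚ)))

≤-trans : ∀ x y z → x ≤ y → y ≤ z → x ≤ z
≤-trans x y z x≤y y≤z = nonneg⇒≤ x z (≤⇒nonneg x y x≤y ⊕ ≤⇒nonneg y z y≤z) λ n →
  solve 3 (λ x y z → y :- x :+ (z :- y) := z :- x) refl (seq x n) (seq y n) (seq z n)

-- A record, so that types are compared without unfolding fromℕ.
record Within (C : ℝ) (a : ℕ) : Set where
  constructor within
  field fits : fromℕ a ≤ C

open Within public

within-antitone : ∀ {C a b} → a ℕ.≤ b → Within C b → Within C a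
within-antitone {C} {a} {b} a≤b (within b≤C) = within (≤-trans (fromℕ a) (fromℕ b) C
  (λ {ε} 0<ε → 0 , λ _ _ → ℚ.≤-trans (/1-mono-≤ a≤b) (p≤p+q (ℤ.+ b ℚ./ 1) (ℚ.<⇒≤ 0<ε))) b≤C)

-- One decidable comparison of rationals at the index `K` settles the matter: if it succeeds, the
-- Cauchy property spreads it to all later indices; if it fails, `x ≤ y` is refuted.
≤-stable : ∀ x y → ¬ ¬ (x ≤ y) → x ≤ y
≤-stable x y ¬¬x≤y {ε} 0<ε = K , bound
  where
  ⅛ δ h : ℚ
  ⅛ = ℤ.+ 1 ℚ./ 8
  -- Success at `K` costs `h + 2δ`, which is below `ε`; the refutation costs `3δ`, which is below
  -- `h`.
  δ = ⅛ ℚ.* ε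
  h = ½ ℚ.* ε
  0<δ = 0<* (ℚ.positive⁻¹ ⅛) 0<ε
  M = proj₁ (cauchy x 0<δ) ; N = proj₁ (cauchy y 0<δ) ; K = M ℕ.⊔ N
  near-x : ∀ {m n} → K ℕ.≤ m → K ℕ.≤ n → seq x m ℚ.≤ seq x n ℚ.+ δ
  near-x {m} {n} m≥ n≥ = ℚ.<⇒≤ (∣p-q∣<r⇒p<q+r {seq x m} {seq x n}
    (proj₂ (cauchy x 0<δ) m n (ℕ.m⊔n≤o⇒m≤o M N m≥) (ℕ.m⊔n≤o⇒m≤o M N n≥)))
  near-y : ∀ {m n} → K ℕ.≤ m → K ℕ.≤ n → seq y m ℚ.≤ seq y n ℚ.+ δ
  near-y {m} {n} m≥ n≥ = ℚ.<⇒≤ (∣p-q∣<r⇒p<q+r {seq y m} {seq y n}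
    (proj₂ (cauchy y 0<δ) m n (ℕ.m⊔n≤o⇒n≤o M N m≥) (ℕ.m⊔n≤o⇒n≤o M N n≥)))
  open ℚ.≤-Reasoning
  bound : ∀ n → K ℕ.≤ n → seq x n ℚ.≤ seq y n ℚ.+ ε
  bound n n≥ with seq x K ℚ.≤? seq y K ℚ.+ h
  ... | yes xK≤ = begin
    seq x n                              ≤⟨ near-x n≥ ℕ.≤-refl ⟩
    seq x K ℚ.+ δ                        ≤⟨ ℚ.+-monoˡ-≤ δ xK≤ ⟩
    seq y K ℚ.+ h ℚ.+ δ                  ≤⟨ ℚ.+-monoˡ-≤ δ (ℚ.+-monoˡ-≤ h (near-y ℕ.≤-refl n≥)) ⟩
    seq y n ℚ.+ δ ℚ.+ h ℚ.+ δ            ≤⟨ p≤p+q _ (ℚ.<⇒≤ (0<½* (0<½* 0<ε))) ⟩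
    seq y n ℚ.+ δ ℚ.+ h ℚ.+ δ ℚ.+ ½ ℚ.* (½ ℚ.* ε)
      ≡⟨ solve 2 (λ y e → y :+ con ⅛ :* e :+ con ½ :* e :+ con ⅛ :* e :+ con ½ :* (con ½ :* e) := y :+ e)
               refl (seq y n) ε ⟩
    seq y n ℚ.+ ε                        ∎
  ... | no xK≰ = ⊥-elim (¬¬x≤y λ x≤y →
    let L , g = x≤y 0<δ
        k = K ℕ.⊔ L
        k≥K = ℕ.m≤m⊔n K L
    in xK≰ (begin
      seq x K                    ≤⟨ near-x ℕ.≤-refl k≥K ⟩
      seq x k ℚ.+ δ              ≤⟨ ℚ.+-monoˡ-≤ δ (g k (ℕ.m≤n⊔m K L)) ⟩
      seq y k ℚ.+ δ ℚ.+ δ        ≤⟨ ℚ.+-monoˡ-≤ δ (ℚ.+-monoˡ-≤ δ (near-y k≥K ℕ.≤-refl)) ⟩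
      seq y K ℚ.+ δ ℚ.+ δ ℚ.+ δ  ≤⟨ p≤p+q _ (ℚ.<⇒≤ 0<δ) ⟩
      seq y K ℚ.+ δ ℚ.+ δ ℚ.+ δ ℚ.+ δ
        ≡⟨ solve 2 (λ y e → let d = con ⅛ :* e in y :+ d :+ d :+ d :+ d := y :+ con ½ :* e)
                 refl (seq y K) ε ⟩
      seq y K ℚ.+ h              ∎))

-- Excluded middle for `P` is irrefutable, which suffices for a stable goal.
≤-by-cases : ∀ {P : Set} x y → (P → x ≤ y) → (¬ P → x ≤ y) → x ≤ y
≤-by-cases x y P⇒x≤y ¬P⇒x≤y = ≤-stable x y λ x≰y → x≰y (¬P⇒x≤y λ p → x≰y (P⇒x≤y p))

-- Finite sets

subset-induction : ∀ {n} (P : Subset n → Set) → P ⊥ →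
  (∀ {i X} → i ∉ X → P X → P (X ∪ ⁅ i ⁆)) → ∀ X → P X
subset-induction P P⊥ P∪ [] = P⊥
subset-induction P P⊥ P∪ (x ∷ X) = from-tail x
  where
  P-outside : P (outside ∷ X)
  P-outside = subset-induction (P ∘ (outside ∷_)) P⊥ (λ i∉X → P∪ (i∉X ∘ drop-there)) X
  from-tail : ∀ x → P (x ∷ X)
  from-tail outside = P-outside
  from-tail inside  = subst (λ Y → P (inside ∷ Y)) (∪-identityʳ X)
    (P∪ {zero} {outside ∷ X} (λ ()) P-outside)

∪-lub : ∀ {n} {X Y Z : Subset n} → X ⊆ Z → Y ⊆ Z → X ∪ Y ⊆ Z
∪-lub {X = X} {Y} X⊆Z Y⊆Z i∈ = [ X⊆Z , Y⊆Z ]′ (x∈p∪q⁻ X Y i∈)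

⁅⁆⊆ : ∀ {n} {i : Fin n} {X} → i ∈ X → ⁅ i ⁆ ⊆ X
⁅⁆⊆ {X = X} i∈X j∈ = subst (_∈ X) (sym (x∈⁅y⁆⇒x≡y _ j∈)) i∈X

∈⇒∪⁅⁆⊆ : ∀ {n} {i : Fin n} {X} → i ∈ X → X ∪ ⁅ i ⁆ ⊆ X
∈⇒∪⁅⁆⊆ i∈X = ∪-lub id (⁅⁆⊆ i∈X)

i∈X∪⁅i⁆ : ∀ {n} {i : Fin n} X → i ∈ X ∪ ⁅ i ⁆
i∈X∪⁅i⁆ {i = i} X = q⊆p∪q X ⁅ i ⁆ (x∈⁅x⁆ i)

-- Policies.size, for any number of items: the two are definitionally equal.
weight : ∀ {n} → (Fin n → ℕ) → Subset n → ℕ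
weight s X = Vec.sum (Vec.tabulate λ i → if Vec.lookup X i then s i else 0)

weight-⊥ : ∀ {n} (s : Fin n → ℕ) → weight s ⊥ ≡ 0
weight-⊥ {zero}  s = refl
weight-⊥ {suc n} s = weight-⊥ (s ∘ suc)

weight-mono : ∀ {n} (s : Fin n → ℕ) {X Y} → X ⊆ Y → weight s X ℕ.≤ weight s Y
weight-mono s {[]} {[]} X⊆Y = ℕ.z≤n
weight-mono s {outside ∷ X} {y ∷ Y} X⊆Y =
  ℕ.≤-trans (weight-mono (s ∘ suc) (drop-∷-⊆ X⊆Y)) (ℕ.m≤n+m _ _)
weight-mono s {inside ∷ X} {y ∷ Y} X⊆Y with X⊆Y Vec.here
... | Vec.here = ℕ.+-monoʳ-≤ (s zero) (weight-mono (s ∘ suc) (drop-∷-⊆ X⊆Y))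

weight-insert : ∀ {n} (s : Fin n → ℕ) {X i} → i ∉ X → weight s (X ∪ ⁅ i ⁆) ≡ weight s X ℕ.+ s i
weight-insert s {inside ∷ X}  {zero}  i∉X = ⊥-elim (i∉X Vec.here)
weight-insert s {outside ∷ X} {zero}  i∉X = trans
  (cong (λ Y → s zero ℕ.+ weight (s ∘ suc) Y) (∪-identityʳ X)) (ℕ.+-comm (s zero) _)
weight-insert s {inside ∷ X}  {suc i} i∉X = trans
  (cong (s zero ℕ.+_) (weight-insert (s ∘ suc) (i∉X ∘ Vec.there))) (sym (ℕ.+-assoc (s zero) _ _))
weight-insert s {outside ∷ X} {suc i} i∉X = weight-insert (s ∘ suc) (i∉X ∘ Vec.there)

weight-∪⁅⁆ : ∀ {n} (s : Fin n → ℕ) X i → weight s (X ∪ ⁅ i ⁆) ℕ.≤ weight s X ℕ.+ s i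
weight-∪⁅⁆ s X i with i ∈? X
... | yes i∈X = ℕ.≤-trans (weight-mono s (∈⇒∪⁅⁆⊆ i∈X)) (ℕ.m≤m+n _ _)
... | no  i∉X = ℕ.≤-reflexive (weight-insert s i∉X)

-- Total sizes of item lists and the block structure.

total : ∀ {n} → (Fin n → ℕ) → List (Fin n) → ℕ
total s = sum ∘ map s

total-++ : ∀ {n} (s : Fin n → ℕ) xs ys → total s (xs ++ ys) ≡ total s xs ℕ.+ total s ys
total-++ s xs ys = trans (cong sum (map-++ s xs ys)) (sum-++ (map s xs) (map s ys))

-- The accumulator `X` absorbs the list item by item. Uniqueness keeps the remaining items outside
-- it, so that sizes add exactly.
unique-total : ∀ {n} (s : Fin n → ℕ) {X Z xs} → Unique xs → All (_∉ X) xs →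
  X ⊆ Z → All (_∈ Z) xs → weight s X ℕ.+ total s xs ℕ.≤ weight s Z
unique-total s [] [] X⊆Z [] = ℕ.≤-trans (ℕ.≤-reflexive (ℕ.+-identityʳ _)) (weight-mono s X⊆Z)
unique-total s {X} {Z} {i ∷ xs} (i≢xs ∷ unique) (i∉X ∷ xs∉X) X⊆Z (i∈Z ∷ xs∈Z) = begin
  weight s X ℕ.+ (s i ℕ.+ total s xs)      ≡⟨ ℕ.+-assoc (weight s X) (s i) _ ⟨
  weight s X ℕ.+ s i ℕ.+ total s xs        ≡⟨ cong (ℕ._+ total s xs) (weight-insert s i∉X) ⟨
  weight s (X ∪ ⁅ i ⁆) ℕ.+ total s xs
    ≤⟨ unique-total s unique
         (All.zipWith (λ (i≢j , j∉X) j∈ → [ j∉X , i≢j ∘ sym ∘ x∈⁅y⁆⇒x≡y i ]′ (x∈p∪q⁻ X ⁅ i ⁆ j∈))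
           (i≢xs , xs∉X))
         (∪-lub X⊆Z (⁅⁆⊆ i∈Z)) xs∈Z ⟩
  weight s Z ∎
  where open ℕ.≤-Reasoning

unique-total-≤ : ∀ {n} (s : Fin n → ℕ) {Z xs} → Unique xs → (∀ {i} → i List.∈ xs → i ∈ Z) →
  total s xs ℕ.≤ weight s Z
unique-total-≤ s {Z} {xs} unique xs⊆Z = subst (λ w → w ℕ.+ total s xs ℕ.≤ weight s Z) (weight-⊥ s)
  (unique-total s unique (All.tabulate (λ _ → ∉⊥)) ⊥⊆ (All.tabulate xs⊆Z))

-- The geometric sum `(2^N - 1) w`. The extra `w` on the left makes the induction close: together
-- with block 0 it becomes the `2 w` of the shifted sequence.
total-doubling : ∀ {n} (s : Fin n → ℕ) (block : ℕ → List (Fin n)) w N →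
  (∀ k → k ℕ.< N → total s (block k) ℕ.≤ 2 ℕ.^ k ℕ.* w) →
  total s (concat (applyUpTo block N)) ℕ.+ w ℕ.≤ 2 ℕ.^ N ℕ.* w
total-doubling s block w zero    h = ℕ.≤-reflexive (sym (ℕ.*-identityˡ w))
total-doubling s block w (suc N) h = begin
  total s (block 0 ++ rest) ℕ.+ w
    ≡⟨ cong (ℕ._+ w) (total-++ s (block 0) rest) ⟩
  total s (block 0) ℕ.+ total s rest ℕ.+ w
    ≤⟨ ℕ.+-monoˡ-≤ w (ℕ.+-monoˡ-≤ (total s rest) (h 0 (ℕ.s≤s ℕ.z≤n))) ⟩
  1 ℕ.* w ℕ.+ total s rest ℕ.+ w
    ≡⟨ trans (cong (ℕ._+ w) (ℕ.+-comm (1 ℕ.* w) (total s rest)))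
         (trans (ℕ.+-assoc (total s rest) (1 ℕ.* w) w)
           (cong (total s rest ℕ.+_) (ℕ.+-comm (1 ℕ.* w) w))) ⟩
  total s rest ℕ.+ 2 ℕ.* w
    ≤⟨ total-doubling s (block ∘ suc) (2 ℕ.* w) N (λ k k<N →
         subst (total s (block (suc k)) ℕ.≤_) (double k) (h (suc k) (ℕ.s≤s k<N))) ⟩
  2 ℕ.^ N ℕ.* (2 ℕ.* w)
    ≡⟨ double N ⟨
  2 ℕ.^ suc N ℕ.* w ∎
  where
  open ℕ.≤-Reasoning
  rest = concat (applyUpTo (block ∘ suc) N)
  double : ∀ k → 2 ℕ.^ suc k ℕ.* w ≡ 2 ℕ.^ k ℕ.* (2 ℕ.* w)
  double k = trans (cong (ℕ._* w) (ℕ.*-comm 2 (2 ℕ.^ k))) (ℕ.*-assoc (2 ℕ.^ k) 2 w)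

applyUpTo-+ : ∀ {A : Set} (g : ℕ → A) m n →
  applyUpTo g (m ℕ.+ n) ≡ applyUpTo g m ++ applyUpTo (g ∘ (m ℕ.+_)) n
applyUpTo-+ g zero    n = refl
applyUpTo-+ g (suc m) n = cong (g 0 ∷_) (applyUpTo-+ (g ∘ suc) m n)

concat-prefix : ∀ {A : Set} (block : ℕ → List A) {m n} → m ℕ.≤ n →
  ∃[ ys ] concat (applyUpTo block n) ≡ concat (applyUpTo block m) ++ ys
concat-prefix block {m} {n} m≤n = _ , trans
  (cong (concat ∘ applyUpTo block) (sym (ℕ.m+[n∸m]≡n m≤n)))
  (trans (cong concat (applyUpTo-+ block m (n ℕ.∸ m)))
    (sym (concat-++ (applyUpTo block m) (applyUpTo (block ∘ (m ℕ.+_)) (n ℕ.∸ m)))))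

∈-⋃-applyUpTo⁻ : ∀ {n} (Y : ℕ → Subset n) N {i} → i ∈ ⋃ (applyUpTo Y N) → ∃[ k ] k ℕ.< N × i ∈ Y k
∈-⋃-applyUpTo⁻ Y zero    i∈ = ⊥-elim (∉⊥ i∈)
∈-⋃-applyUpTo⁻ Y (suc N) i∈ with x∈p∪q⁻ (Y 0) (⋃ (applyUpTo (Y ∘ suc) N)) i∈
... | inj₁ i∈Y0 = 0 , ℕ.s≤s ℕ.z≤n , i∈Y0
... | inj₂ i∈⋃ with ∈-⋃-applyUpTo⁻ (Y ∘ suc) N i∈⋃
...   | k , k<N , i∈Yk = suc k , ℕ.s≤s k<N , i∈Yk

minimum-≤ : ∀ {m} (s : Fin (suc m) → ℕ) i → minimum s ℕ.≤ s i
minimum-≤ {zero}  s zero    = ℕ.≤-refl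
minimum-≤ {suc m} s zero    = ℕ.m⊓n≤m (s zero) _
minimum-≤ {suc m} s (suc i) = ℕ.≤-trans (ℕ.m⊓n≤n (s zero) _) (minimum-≤ (s ∘ suc) i)

-- By strong induction on `k`: an item of `Y k` missing from its own block lies in some earlier
-- `Y l`.
blocks-cover : ∀ {n} (Y : ℕ → Subset n) (block : ℕ → List (Fin n)) N →
  (∀ k → k ℕ.< N → Enumerates (block k) (Y k ─ ⋃ (applyUpTo Y k))) →
  ∀ k → k ℕ.< N → ∀ {i} → i ∈ Y k → i List.∈ concat (applyUpTo block N)
blocks-cover Y block N lists = <-rec _ λ k cover k<N {i} i∈Yk → cases k cover k<N i∈Yk
  where
  cases : ∀ k → (∀ {l} → l ℕ.< k → l ℕ.< N → ∀ {i} → i ∈ Y l → i List.∈ concat (applyUpTo block N)) →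
          k ℕ.< N → ∀ {i} → i ∈ Y k → i List.∈ concat (applyUpTo block N)
  cases k cover k<N {i} i∈Yk with i ∈? ⋃ (applyUpTo Y k)
  ... | yes i∈⋃ = let l , l<k , i∈Yl = ∈-⋃-applyUpTo⁻ Y k i∈⋃
                  in cover l<k (ℕ.<-trans l<k k<N) i∈Yl
  ... | no i∉⋃ = ∈-concat⁺′
    (Equivalence.from (proj₂ (lists k k<N) i) (x∈p∧x∉q⇒x∈p─q i∈Yk i∉⋃))
    (∈-applyUpTo⁺ block k<N)

-- Decay of the greedy gap

-- For `h = 1/c` this is `a / (4c)`, the share of the remaining gap that a greedy item of size `a`
-- is guaranteed to close.
rate : ℚ → ℕ → ℚ
rate h a = ¼ ℚ.* (ι a ℚ.* h)

-- With h = 1/c this says, up to truncation of the series, P ≤ exp(-a/(4c)).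
record Discount (h : ℚ) (a : ℕ) (P : ℚ) : Set where
  field
    0≤P   : 0ℚ ℚ.≤ P
    decay : ∀ n → expTaylor n (ι a ℚ.* h) ℚ.* P ⁴ ℚ.≤ 1ℚ

open Discount

discount-zero : ∀ h → Discount h 0 1ℚ
discount-zero h .0≤P = 0≤1
discount-zero h .decay n = ℚ.≤-reflexive (trans (ℚ.*-identityʳ _)
  (trans (cong (expTaylor n) (trans (cong (ℚ._* h) ι-0) (ℚ.*-zeroˡ h))) (expTaylor-0 n)))

module Discounting (c : ℕ) (h : ℚ) (0≤h : 0ℚ ℚ.≤ h) (c*h≡1 : ι c ℚ.* h ≡ 1ℚ) where

  0≤rate : ∀ a → 0ℚ ℚ.≤ rate h a
  0≤rate a = 0≤* (ℚ.nonNegative⁻¹ ¼) (0≤* (0≤ι a) 0≤h)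

  rate-4c : ∀ a → rate h a ℚ.* ι (4 ℕ.* c) ≡ ι a
  rate-4c a = begin-equality
    rate h a ℚ.* ι (4 ℕ.* c)         ≡⟨ cong (rate h a ℚ.*_) (ι-* 4 c) ⟩
    rate h a ℚ.* (ι 4 ℚ.* ι c)
      ≡⟨ solve 5 (λ q a v f c → q :* (a :* v) :* (f :* c) := a :* ((q :* f) :* (c :* v))) refl
           ¼ (ι a) h (ι 4) (ι c) ⟩
    ι a ℚ.* ((¼ ℚ.* ι 4) ℚ.* (ι c ℚ.* h))
      ≡⟨ cong₂ (λ p q → ι a ℚ.* (p ℚ.* q)) ¼*ι4 c*h≡1 ⟩
    ι a ℚ.* 1ℚ                       ≡⟨ ℚ.*-identityʳ (ι a) ⟩
    ι a                              ∎
    where open ℚ.≤-Reasoning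

  rate≤1 : ∀ {a} → a ℕ.≤ 4 ℕ.* c → rate h a ℚ.≤ 1ℚ
  rate≤1 {a} a≤4c = subst (rate h a ℚ.≤_) rate-4c≡1
    (ℚ.*-monoˡ-≤-nonNeg ¼ (ℚ.*-monoʳ-≤-nonNeg h {{ℚ.nonNegative 0≤h}} (ι-mono-≤ a≤4c)))
    where
    rate-4c≡1 : rate h (4 ℕ.* c) ≡ 1ℚ
    rate-4c≡1 = trans (cong (λ p → ¼ ℚ.* (p ℚ.* h)) (ι-* 4 c))
      (trans (solve 4 (λ q f c v → q :* (f :* c :* v) := (q :* f) :* (c :* v)) refl ¼ (ι 4) (ι c) h)
        (cong₂ ℚ._*_ ¼*ι4 c*h≡1))

  -- The exponent grows from `a/c` to `(a + b)/c`, that is, by four times `rate h b`, which the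
  -- fourth power of the new factor absorbs.
  discount-step : ∀ {a P} b → b ℕ.≤ 4 ℕ.* c → Discount h a P →
                  Discount h (a ℕ.+ b) (P ℚ.* (1ℚ ℚ.- rate h b))
  discount-step {a} {P} b b≤4c D .0≤P = 0≤* (D .0≤P) (q≤p⇒0≤p-q (rate≤1 {b} b≤4c))
  discount-step {a} {P} b b≤4c D .decay n = begin
    expTaylor n (ι (a ℕ.+ b) ℚ.* h) ℚ.* (P ℚ.* w) ⁴
      ≡⟨ cong (λ t → expTaylor n t ℚ.* (P ℚ.* w) ⁴) (trans (cong (ℚ._* h) (ι-+ a b))
           (solve 3 (λ a b v → let u = con ¼ :* (b :* v) in
             (a :+ b) :* v := a :* v :+ u :+ u :+ u :+ u) refl (ι a) (ι b) h)) ⟩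
    e ℚ.* (P ℚ.* w) ⁴
      ≡⟨ solve 3 (λ e p w → e :* (((p :* w) :* (p :* w)) :* ((p :* w) :* (p :* w)))
           := (e :* ((w :* w) :* (w :* w))) :* ((p :* p) :* (p :* p))) refl e P w ⟩
    (e ℚ.* w ⁴) ℚ.* P ⁴
      ≤⟨ ℚ.*-monoʳ-≤-nonNeg (P ⁴) {{ℚ.nonNegative (0≤* 0≤P² 0≤P²)}}
           (expTaylor-decay⁴ n (0≤* (0≤ι a) 0≤h) (0≤rate b) (rate≤1 {b} b≤4c)) ⟩
    expTaylor n t ℚ.* P ⁴     ≤⟨ D .decay n ⟩
    1ℚ                        ∎
    where
    open ℚ.≤-Reasoning
    t = ι a ℚ.* h ; u = rate h b ; w = 1ℚ ℚ.- u
    e = expTaylor n (t ℚ.+ u ℚ.+ u ℚ.+ u ℚ.+ u)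
    0≤P² = 0≤* (D .0≤P) (D .0≤P)

  -- From `c ≤ a` the exponent `a/c` is at least 1, where the Taylor polynomial is at least
  -- `expSum n`.
  discount-final : ∀ {a P} → c ℕ.≤ a → Discount h a P → ∀ n → P ℚ.≤ seq 1/∜𝑒 n
  discount-final {a} {P} c≤a D n = ≤1/∜𝑒 (D .0≤P) n (ℚ.≤-trans
    (ℚ.*-monoʳ-≤-nonNeg (P ⁴) {{ℚ.nonNegative (0≤* 0≤P² 0≤P²)}} (expSum≤expTaylor n
      (subst (ℚ._≤ ι a ℚ.* h) c*h≡1
        (ℚ.*-monoʳ-≤-nonNeg h {{ℚ.nonNegative 0≤h}} (ι-mono-≤ c≤a)))))
    (D .decay n))
    where 0≤P² = 0≤* (D .0≤P) (D .0≤P)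

-- x = f X, o = f O, v = f (X ∪ O) and y = f (X ∪ ⁅ i ⁆), where i has size a and density d.
value-bound : ∀ x o v y d u P W K a → 0ℚ ℚ.≤ u → u ℚ.≤ 1ℚ → W ℚ.≤ K → u ℚ.* K ≡ a →
  (∀ n → a ℚ.* seq d n ≡ seq y n ℚ.- seq x n) →
  Nonneg (x + fromℚ P * o - o) → Nonneg (x + fromℚ W * d - v) → Nonneg (v - o) → Nonneg d →
  Nonneg (y + fromℚ (P ℚ.* (1ℚ ℚ.- u)) * o - o)
-- The part scaled by `u` says `o ≤ x + K d`. As `u K d = a d = y - x`, this gives
-- `u (o - x) ≤ y - x`, hence `o - y ≤ (1 - u) (o - x) ≤ (1 - u) P o`.
value-bound x o v y d u P W K a 0≤u u≤1 W≤K uK≡a ad≡y-x value marginal v-o 0≤d = nonneg-cong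
  (nonneg-scale (q≤p⇒0≤p-q u≤1) value
    ⊕ nonneg-scale 0≤u (marginal ⊕ v-o ⊕ nonneg-scale (q≤p⇒0≤p-q W≤K) 0≤d))
  (λ n → identity (seq x n) (seq o n) (seq v n) (seq y n) (seq d n) (ad≡y-x n))
  where
  open ℚ.≤-Reasoning
  identity : ∀ x o v y d → a ℚ.* d ≡ y ℚ.- x →
    (1ℚ ℚ.- u) ℚ.* (x ℚ.+ P ℚ.* o ℚ.- o)
      ℚ.+ u ℚ.* (x ℚ.+ W ℚ.* d ℚ.- v ℚ.+ (v ℚ.- o) ℚ.+ (K ℚ.- W) ℚ.* d)
    ≡ y ℚ.+ P ℚ.* (1ℚ ℚ.- u) ℚ.* o ℚ.- o
  identity x o v y d ad≡y-x = begin-equality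
    (1ℚ ℚ.- u) ℚ.* (x ℚ.+ P ℚ.* o ℚ.- o)
      ℚ.+ u ℚ.* (x ℚ.+ W ℚ.* d ℚ.- v ℚ.+ (v ℚ.- o) ℚ.+ (K ℚ.- W) ℚ.* d)
      ≡⟨ solve 8 (λ x o v d u P W K →
           (con 1ℚ :- u) :* (x :+ P :* o :- o) :+ u :* (x :+ W :* d :- v :+ (v :- o) :+ (K :- W) :* d)
           := x :+ P :* (con 1ℚ :- u) :* o :- o :+ (u :* K) :* d)
         refl x o v d u P W K ⟩
    x ℚ.+ P ℚ.* (1ℚ ℚ.- u) ℚ.* o ℚ.- o ℚ.+ (u ℚ.* K) ℚ.* d
      ≡⟨ cong (x ℚ.+ P ℚ.* (1ℚ ℚ.- u) ℚ.* o ℚ.- o ℚ.+_) (trans (cong (ℚ._* d) uK≡a) ad≡y-x) ⟩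
    x ℚ.+ P ℚ.* (1ℚ ℚ.- u) ℚ.* o ℚ.- o ℚ.+ (y ℚ.- x)
      ≡⟨ solve 4 (λ x z o y → x :+ z :- o :+ (y :- x) := y :+ z :- o) refl x (P ℚ.* (1ℚ ℚ.- u) ℚ.* o) o y ⟩
    y ℚ.+ P ℚ.* (1ℚ ℚ.- u) ℚ.* o ℚ.- o ∎

-- The numbers at the moment an item of O overflows, with P ≤ r.
overflow-bound : ∀ x y v i t o r P → (∀ n → P ℚ.≤ seq r n) → (∀ n → seq r n ℚ.≤ 1ℚ) → 0ℚ ℚ.≤ P →
  Nonneg o → Nonneg (y - x) → Nonneg (t - i) → Nonneg (x + i - v) → Nonneg (v + fromℚ P * o - o) →
  (1ℝ - r) * o ≤ y + t
overflow-bound x y v i t o r P P≤r r≤1 0≤P 0≤o y-x t-i x+i-v value = nonneg⇒≤ ((1ℝ - r) * o) (y + t)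
  -- The chain is `y + t ≥ x + i ≥ v ≥ (1 - P) o ≥ (1 - r) o`.
  (y-x ⊕ t-i ⊕ x+i-v ⊕ value
    ⊕ nonneg-* {o} (r - fromℚ P) 1ℚ (λ n → q≤p⇒0≤p-q (P≤r n))
        (λ n → ℚ.+-mono-≤ (r≤1 n) (ℚ.neg-antimono-≤ 0≤P)) (ℚ.positive⁻¹ 1ℚ) 0≤o)
  (λ n → solve 8 (λ y x t i v P o r →
      y :- x :+ (t :- i) :+ (x :+ i :- v) :+ (v :+ P :* o :- o) :+ (r :- P) :* o
      := y :+ t :- (con 1ℚ :- r) :* o) refl
    (seq y n) (seq x n) (seq t n) (seq i n) (seq v n) P (seq o n) (seq r n))

x∈p─q⇒x∉q : ∀ {n} {p q : Subset n} {x} → x ∈ p ─ q → x ∉ q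
x∈p─q⇒x∉q {p = _ ∷ _} {inside ∷ _}  {suc _} (Vec.there x∈) (Vec.there x∈q) = x∈p─q⇒x∉q x∈ x∈q
x∈p─q⇒x∉q {p = _ ∷ _} {outside ∷ _} {suc _} (Vec.there x∈) (Vec.there x∈q) = x∈p─q⇒x∉q x∈ x∈q

-- Submodular gains and greedy densities.

module Analysis {m : ℕ} (s : Fin (suc m) → ℕ) (s>0 : ∀ i → NonZero (s i))
  (f : Subset (suc m) → ℝ) (0≤f : ∀ X → 0ℝ ≤ f X) (f⊥≃0 : f ⊥ ≃ 0ℝ)
  (f-mono : Monotone f) (f-submodular : Submodular f) where

  open Policies s s>0 f

  private
    Item  = Fin (suc m)
    Items = Subset (suc m)

  mono : ∀ {X Y} → X ⊆ Y → Nonneg (f Y - f X)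
  mono {X} {Y} X⊆Y = ≤⇒nonneg (f X) (f Y) (f-mono X⊆Y)

  submodular : ∀ X Y → Nonneg (f X + f Y - (f (X ∪ Y) + f (X ∩ Y)))
  submodular X Y = ≤⇒nonneg (f (X ∪ Y) + f (X ∩ Y)) (f X + f Y) (f-submodular X Y)

  f-nonneg : ∀ X → Nonneg (f X)
  f-nonneg X = nonneg (0≤f X)

  subadditive : ∀ X Y → Nonneg (f X + f Y - f (X ∪ Y))
  subadditive X Y = nonneg-cong
    (submodular X Y ⊕ f-nonneg (X ∩ Y))
    (λ n → solve 4 (λ x y u v → x :+ y :- (u :+ v) :+ v := x :+ y :- u) refl
      (seq (f X) n) (seq (f Y) n) (seq (f (X ∪ Y)) n) (seq (f (X ∩ Y)) n))

  module _ (X : Items) (d : ℝ) where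
    -- The hypothesis on single items belongs to the induction motive because it mentions `Z` and
    -- has to be restricted to smaller sets.
    P : Items → Set
    P Z = (∀ {i} → i ∈ Z → Nonneg (f X + fromℚ (ι (s i)) * d - f (X ∪ ⁅ i ⁆))) →
          Nonneg (f X + fromℚ (ι (weight s Z)) * d - f (X ∪ Z))
    base : P ⊥
    base _ = nonneg-cong
      (mono (∪-lub {Y = ⊥} id ⊥⊆))
      (λ n → trans (solve 3 (λ x y d → x :- y := x :+ con 0ℚ :* d :- y) refl
               (seq (f X) n) (seq (f (X ∪ ⊥)) n) (seq d n))
             (cong (λ w → seq (f X) n ℚ.+ w ℚ.* seq d n ℚ.- seq (f (X ∪ ⊥)) n)
               (trans (sym ι-0) (cong ι (sym (weight-⊥ s))))))
    step : ∀ {i Z} → i ∉ Z → P Z → P (Z ∪ ⁅ i ⁆)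
    step {i} {Z} i∉Z PZ h = nonneg-cong
      -- Submodularity for `X ∪ Z` and `X ∪ ⁅ i ⁆`: the intersection contains `X`, so by
      -- monotonicity the two gains over `X` bound the joint gain.
      (PZ (h ∘ p⊆p∪q ⁅ i ⁆) ⊕ h (i∈X∪⁅i⁆ Z) ⊕ submodular A B
        ⊕ mono (λ x∈X → x∈p∩q⁺ (p⊆p∪q Z x∈X , p⊆p∪q ⁅ i ⁆ x∈X)))
      (λ n → trans
        (solve 8 (λ x a d z b i u v → let z' = x :+ a :* d :- z ; i' = x :+ b :* d :- i in
            z' :+ i' :+ (z :+ i :- (u :+ v)) :+ (v :- x) := x :+ (a :+ b) :* d :- u) refl
          (seq (f X) n) (ι (weight s Z)) (seq d n) (seq (f (X ∪ Z)) n) (ι (s i)) (seq (f (X ∪ ⁅ i ⁆)) n)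
          (seq (f (A ∪ B)) n) (seq (f (A ∩ B)) n))
        (cong₂ (λ w U → seq (f X) n ℚ.+ w ℚ.* seq d n ℚ.- seq (f U) n)
          (trans (sym (ι-+ (size Z) (s i))) (cong ι (sym (weight-insert s i∉Z))))
          A∪B≡))
      where
      A = X ∪ Z ; B = X ∪ ⁅ i ⁆
      A∪B≡ : A ∪ B ≡ X ∪ (Z ∪ ⁅ i ⁆)
      A∪B≡ = ⊆-antisym
        (∪-lub {X = A} (∪-lub (p⊆p∪q _) (q⊆p∪q X _ ∘ p⊆p∪q _))
          (∪-lub (p⊆p∪q _) (q⊆p∪q X _ ∘ q⊆p∪q Z _)))
        (∪-lub {X = X} (p⊆p∪q B ∘ p⊆p∪q Z)
          (∪-lub (p⊆p∪q B ∘ q⊆p∪q X Z) (q⊆p∪q A B ∘ q⊆p∪q X ⁅ i ⁆)))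

    marginals : ∀ Z → P Z
    marginals = subset-induction P base step

  -- density X i, shielded from unfolding
  opaque
    unfolding 1/ι

    dens : Items → Item → ℝ
    dens = density

    dens-seq : ∀ X i n → seq (dens X i) n ≡
      (seq (f (X ∪ ⁅ i ⁆)) n ℚ.- seq (f X) n) ℚ.* 1/ι (s i) {{s>0 i}}
    dens-seq X i n = refl

    dens-maximal : ∀ {X R i j} → IsDensest X R i → j ∈ R → dens X j ≤ dens X i
    dens-maximal (_ , maximal) = maximal _

  gain : ∀ X i n → ι (s i) ℚ.* seq (dens X i) n ≡ seq (f (X ∪ ⁅ i ⁆)) n ℚ.- seq (f X) n
  gain X i n = begin-equality
    ι (s i) ℚ.* seq (dens X i) n    ≡⟨ cong (ι (s i) ℚ.*_) (dens-seq X i n) ⟩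
    ι (s i) ℚ.* (g ℚ.* v)           ≡⟨ solve 3 (λ a g v → a :* (g :* v) := (a :* v) :* g) refl (ι (s i)) g v ⟩
    (ι (s i) ℚ.* v) ℚ.* g           ≡⟨ cong (ℚ._* g) (ι-inverse (s i) {{s>0 i}}) ⟩
    1ℚ ℚ.* g                        ≡⟨ ℚ.*-identityˡ g ⟩
    g                               ∎
    where
    open ℚ.≤-Reasoning
    g = seq (f (X ∪ ⁅ i ⁆)) n ℚ.- seq (f X) n
    v = 1/ι (s i) {{s>0 i}}

  dens-nonneg : ∀ X i → Nonneg (dens X i)
  dens-nonneg X i = nonneg-cong
    (nonneg-scale (0≤1/ι (s i) {{s>0 i}}) (mono (p⊆p∪q ⁅ i ⁆)))
    (λ n → trans (ℚ.*-comm (1/ι (s i) {{s>0 i}}) _) (sym (dens-seq X i n)))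

  -- An item already in `X` gains nothing, and the density of `i` is nonnegative; for a remaining
  -- item the greedy choice decides.
  densest-bound : ∀ {X R i} → IsDensest X R i → ∀ {j} → j ∈ X ⊎ j ∈ R →
                  Nonneg (f X + fromℚ (ι (s j)) * dens X i - f (X ∪ ⁅ j ⁆))
  densest-bound {X} {R} {i} _ {j} (inj₁ j∈X) = nonneg-cong
    (mono (∈⇒∪⁅⁆⊆ j∈X) ⊕ nonneg-scale (0≤ι (s j)) (dens-nonneg X i))
    (λ n → solve 3 (λ x y z → x :- y :+ z := x :+ z :- y) refl
      (seq (f X) n) (seq (f (X ∪ ⁅ j ⁆)) n) (ι (s j) ℚ.* seq (dens X i) n))
  densest-bound {X} {R} {i} densest {j} (inj₂ j∈R) = nonneg-cong
    (nonneg-scale (0≤ι (s j)) (≤⇒nonneg (dens X j) (dens X i) (dens-maximal {X} {R} {i} {j} densest j∈R)))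
    (λ n → let x = seq (f X) n ; y = seq (f (X ∪ ⁅ j ⁆)) n
               b = ι (s j) ; d = seq (dens X i) n ; e = seq (dens X j) n in trans
      (solve 3 (λ b d e → b :* (d :- e) := b :* d :- b :* e) refl b d e)
      (trans (cong (λ p → b ℚ.* d ℚ.- p) (gain X j n))
        (solve 3 (λ z x y → z :- (y :- x) := x :+ z :- y) refl (b ℚ.* d) x y)))

  -- Runs of a policy and of the greedy procedure.

  run-⊆ : ∀ {C X Π Y} → Run C X Π Y → X ⊆ Y
  run-⊆ done          = id
  run-⊆ (add _ r)     = run-⊆ r ∘ p⊆p∪q _
  run-⊆ (discard _ r) = run-⊆ r

  -- A prefix that fits as a whole never meets a discard. An item already present only makes the
  -- current set smaller than the bound, so `weight-∪⁅⁆` is enough.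
  run-prefix : ∀ {C X Y} xs {ys} → Run C X (xs ++ ys) Y → Within C (size X ℕ.+ total s xs) →
               ∀ {i} → i List.∈ xs → i ∈ Y
  run-prefix {X = X} (i ∷ xs) (add _ r) w (here refl) = run-⊆ r (i∈X∪⁅i⁆ X)
  run-prefix {X = X} (i ∷ xs) (add _ r) w (there j∈)  = run-prefix xs r
    (within-antitone (ℕ.≤-trans (ℕ.+-monoˡ-≤ (total s xs) (weight-∪⁅⁆ s X i))
      (ℕ.≤-reflexive (ℕ.+-assoc (size X) (s i) _))) w) j∈
  run-prefix {X = X} (i ∷ xs) (discard i≰ r) w = ⊥-elim (i≰
    (fits (within-antitone (ℕ.+-monoʳ-≤ (size X) (ℕ.m≤m+n (s i) _)) w)))

  greedy-⊆ : ∀ {c X R Y} → Greedy c X R Y → X ⊆ Y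
  greedy-⊆ (done _)     = id
  greedy-⊆ (take _ _ g) = greedy-⊆ g ∘ p⊆p∪q _
  greedy-⊆ (skip _ _ g) = greedy-⊆ g

  greedy-size : ∀ {c X R Y} → Greedy c X R Y → size X ℕ.≤ c → size Y ℕ.≤ c
  greedy-size (done _)                     X≤c = X≤c
  greedy-size (take {X} {i = i} _ i≤c g)   X≤c = greedy-size g (ℕ.≤-trans (weight-∪⁅⁆ s X i) i≤c)
  greedy-size (skip _ _ g)                 X≤c = greedy-size g X≤c

  -- A run that starts from ⊥ packs the first item of Π that fits into C.
  run-first : ∀ {C Π Y i} → Run C ⊥ Π Y → AllPairs (λ i j → f ⁅ j ⁆ ≤ f ⁅ i ⁆) Π →
              i List.∈ Π → Within C (s i) → f ⁅ i ⁆ ≤ f Y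
  run-first {Y = Y} {i} (add {i = k} _ r) (k≥ ∷ _) i∈Π _ =
    ≤-trans (f ⁅ i ⁆) (f ⁅ k ⁆) (f Y) (head-best i∈Π) (f-mono (run-⊆ r ∘ q⊆p∪q ⊥ ⁅ k ⁆))
    where
    head-best : ∀ {i} → i List.∈ _ → f ⁅ i ⁆ ≤ f ⁅ k ⁆
    head-best (here refl)  = f-mono {⁅ k ⁆} {⁅ k ⁆} id
    head-best (there i∈Π)  = All.lookup k≥ i∈Π
  run-first (discard {i = k} k≰ r) (_ ∷ sorted) (there i∈Π) fits = run-first r sorted i∈Π fits
  run-first (discard {i = k} k≰ r) _ (here refl) w = ⊥-elim (k≰ (fits (subst (Within _) size≡ w)))
    where
    size≡ : s k ≡ size ⊥ ℕ.+ s k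
    size≡ = cong (ℕ._+ s k) (sym (weight-⊥ s))

  member-size : ∀ {i Z} → i ∈ Z → s i ℕ.≤ size Z
  member-size {i} {Z} i∈Z = subst (ℕ._≤ size Z)
    (trans (weight-insert s {⊥} {i} ∉⊥) (cong (ℕ._+ s i) (weight-⊥ s)))
    (weight-mono s (∪-lub {X = ⊥} ⊥⊆ (⁅⁆⊆ i∈Z)))

  -- The greedy set and one further item against a competitor.

  module Competitor (O : Items) (t : ℝ) (0≤t : 0ℝ ≤ t) (t≥ : ∀ {i} → i ∈ O → f ⁅ i ⁆ ≤ t) where

    share : ℝ
    share = (1ℝ - 1/∜𝑒) * f O

    1/∜𝑒*fO-nonneg : Nonneg (1/∜𝑒 * f O)
    1/∜𝑒*fO-nonneg = nonneg-* {f O} 1/∜𝑒 1ℚ 0≤1/∜𝑒 1/∜𝑒-upper (ℚ.positive⁻¹ 1ℚ) (f-nonneg O)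

    share≤ : ∀ x → f O ≤ x → share ≤ x
    share≤ x fO≤x = nonneg⇒≤ share x (≤⇒nonneg (f O) x fO≤x ⊕ 1/∜𝑒*fO-nonneg) λ n →
      solve 3 (λ o x r → x :- o :+ r :* o := x :- (con 1ℚ :- r) :* o) refl
        (seq (f O) n) (seq x n) (seq 1/∜𝑒 n)

    single-item : (∀ {i j} → i ∈ O → j ∈ O → i ≡ j) → f O ≤ t
    single-item unique with nonempty? O
    ... | yes (i , i∈O) = ≤-trans (f O) (f ⁅ i ⁆) t
      (f-mono λ j∈O → subst (_∈ ⁅ i ⁆) (unique i∈O j∈O) (x∈⁅x⁆ i)) (t≥ i∈O)
    ... | no empty = subst (λ Z → f Z ≤ t) (sym (Empty-unique empty))
      (≤-trans (f ⊥) 0ℝ t (proj₁ f⊥≃0) 0≤t)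

    module Loop (c : ℕ) (O≤4c : size O ℕ.≤ 4 ℕ.* c)
      (h : ℚ) (0≤h : 0ℚ ℚ.≤ h) (c*h≡1 : ι c ℚ.* h ≡ 1ℚ) where

      open Discounting c h 0≤h c*h≡1

      Value : Items → ℚ → Set
      Value X P = Nonneg (f X + fromℚ P * f O - f O)

      -- Whether `i` fits is left open, since the bound is also applied to the item that overflows.
      value-step : ∀ {X R i P} → IsDensest X R i → s i ℕ.≤ 4 ℕ.* c →
        (∀ {j} → j ∈ O → j ∈ X ⊎ j ∈ R) → Value X P → Value (X ∪ ⁅ i ⁆) (P ℚ.* (1ℚ ℚ.- rate h (s i)))
      value-step {X} {R} {i} {P} densest i≤4c alive value = value-bound
        (f X) (f O) (f (X ∪ O)) (f (X ∪ ⁅ i ⁆)) (dens X i) (rate h (s i)) P (ι (weight s O)) (ι (4 ℕ.* c)) (ι (s i))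
        (0≤rate (s i)) (rate≤1 {s i} i≤4c) (ι-mono-≤ {weight s O} {4 ℕ.* c} O≤4c) (rate-4c (s i)) (gain X i) value
        (marginals X (dens X i) O (λ {j} j∈O → densest-bound {X} {R} {i} densest {j} (alive j∈O)))
        (mono {O} {X ∪ O} (q⊆p∪q X O)) (dens-nonneg X i)

      -- Invariants: no item of `O` has been rejected so far, and `R` avoids `X`, so that sizes add.
      -- Rejecting an item outside `O` changes nothing, the first rejected item of `O` ends the
      -- argument, and if there is none, `Y` contains `O`.
      greedy-loop : ∀ {X R Y P} → Greedy c X R Y →
        (∀ {j} → j ∈ O → j ∈ X ⊎ j ∈ R) → (∀ {j} → j ∈ R → j ∉ X) →
        size X ℕ.≤ c → Discount h (size X) P → Value X P → share ≤ f Y + t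
      greedy-loop {Y = Y} (done empty) alive _ _ _ _ = share≤ (f Y + t)
        (nonneg⇒≤ (f O) (f Y + t)
          (mono {O} {Y} (λ {j} j∈O → [ id , (λ j∈R → ⊥-elim (empty (j , j∈R))) ]′ (alive {j} j∈O)) ⊕ nonneg {t} 0≤t)
          (λ n → solve 3 (λ x o t → x :- o :+ t := x :+ t :- o) refl
            (seq (f Y) n) (seq (f O) n) (seq t n)))
      greedy-loop {X} {R} {Y} {P} (take {i = i} densest i-fits g) alive disjoint X≤c D value =
        greedy-loop g alive′ disjoint′ (ℕ.≤-trans (ℕ.≤-reflexive size≡) i-fits)
          (subst (λ a → Discount h a (P ℚ.* (1ℚ ℚ.- rate h (s i)))) (sym size≡) (discount-step (s i) i≤4c D))
          (value-step {X} {R} {i} {P} densest i≤4c alive value)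
        where
        i≤4c : s i ℕ.≤ 4 ℕ.* c
        i≤4c = ℕ.≤-trans (ℕ.m≤n+m (s i) (size X)) (ℕ.≤-trans i-fits (ℕ.m≤m+n c _))
        size≡ : size (X ∪ ⁅ i ⁆) ≡ size X ℕ.+ s i
        size≡ = weight-insert s (disjoint (proj₁ densest))
        alive′ : ∀ {j} → j ∈ O → j ∈ X ∪ ⁅ i ⁆ ⊎ j ∈ R Subset.- i
        alive′ {j} j∈O with alive j∈O | j Fin.≟ i
        ... | inj₁ j∈X | _        = inj₁ (p⊆p∪q ⁅ i ⁆ j∈X)
        ... | inj₂ j∈R | yes refl = inj₁ (i∈X∪⁅i⁆ X)
        ... | inj₂ j∈R | no j≢i   = inj₂ (x∈p∧x≢y⇒x∈p-y j∈R j≢i)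
        disjoint′ : ∀ {j} → j ∈ R Subset.- i → j ∉ X ∪ ⁅ i ⁆
        disjoint′ j∈ j∈X∪i =
          [ disjoint (p─q⊆p R ⁅ i ⁆ j∈) , x∈p─q⇒x∉q j∈ ]′ (x∈p∪q⁻ X ⁅ i ⁆ j∈X∪i)
      greedy-loop {X} {R} {Y} {P} (skip {i = i} densest i-overflows g) alive disjoint X≤c D value
        with i ∈? O
      ... | no i∉O = greedy-loop g alive′ (disjoint ∘ p─q⊆p R ⁅ i ⁆) X≤c D value
        where
        alive′ : ∀ {j} → j ∈ O → j ∈ X ⊎ j ∈ R Subset.- i
        alive′ {j} j∈O with alive j∈O
        ... | inj₁ j∈X = inj₁ j∈X
        ... | inj₂ j∈R = inj₂ (x∈p∧x≢y⇒x∈p-y j∈R λ { refl → i∉O j∈O })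
      ... | yes i∈O = overflow-bound
        (f X) (f Y) (f (X ∪ ⁅ i ⁆)) (f ⁅ i ⁆) t (f O) 1/∜𝑒 (P ℚ.* (1ℚ ℚ.- rate h (s i)))
        (discount-final (ℕ.<⇒≤ (ℕ.≰⇒> i-overflows)) D′) 1/∜𝑒-upper (D′ .0≤P)
        (f-nonneg O) (mono {X} {Y} (greedy-⊆ g)) (≤⇒nonneg (f ⁅ i ⁆) t (t≥ i∈O)) (subadditive X ⁅ i ⁆)
        (value-step {X} {R} {i} {P} densest i≤4c alive value)
        where
        -- A packed item is bounded by `c`; an overflowing one is bounded through its membership in
        -- `O`.
        i≤4c = ℕ.≤-trans (member-size i∈O) O≤4c
        D′ : Discount h (size X ℕ.+ s i) (P ℚ.* (1ℚ ℚ.- rate h (s i)))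
        D′ = discount-step (s i) i≤4c D

      greedy-share : ∀ {Y} → 𝒫¹ c Y → share ≤ f Y + t
      greedy-share g = greedy-loop g (λ _ → inj₂ ∈⊤) (λ _ → ∉⊥)
        (ℕ.≤-trans (ℕ.≤-reflexive (weight-⊥ s)) ℕ.z≤n)
        (subst (λ a → Discount h a 1ℚ) (sym (weight-⊥ s)) (discount-zero h))
        (nonneg-cong (f-nonneg ⊥) λ n → solve 2 (λ x o → x := x :+ con 1ℚ :* o :- o) refl
          (seq (f ⊥) n) (seq (f O) n))

  -- The two sequences against the optimum.

  module _ {Π¹ Π² : List Item} (isΠ¹ : IsΠ¹ Π¹) (isΠ² : IsΠ² Π²) {C : ℝ} {X₁ X₂ O : Items}
    (output¹ : Output C Π¹ X₁) (output² : Output C Π² X₂) (opt : IsOPT C O) where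

    open IsΠ¹ isΠ¹
    open IsΠ² isΠ²

    private
      O-within : Within C (size O)
      O-within = within (proj₁ opt)

      t≥ : ∀ {i} → i ∈ O → f ⁅ i ⁆ ≤ f X₂
      t≥ {i} i∈O = run-first output² decreasing (Equivalence.from (proj₂ all-items i) ∈⊤)
        (within-antitone (member-size i∈O) O-within)

    open Competitor O (f X₂) (0≤f X₂) t≥

    capacity : ℕ → ℕ
    capacity k = 2 ℕ.^ k ℕ.* s-min

    capacity-nonZero : ∀ k → NonZero (capacity k)
    capacity-nonZero k = ℕ.m*n≢0 (2 ℕ.^ k) s-min {{ℕ.m^n≢0 2 k}} {{minimum-nonZero s s>0}}

    -- Block `j` is part of a greedy set of size at most `capacity j`, so by doubling the blocks up
    -- to `k` form a prefix that fits as a whole.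
    Y⊆X₁ : ∀ {k} → k ℕ.≤ K → Within C (capacity (suc k)) → Y k ⊆ X₁
    Y⊆X₁ {k} k≤K w i∈Y with concat-prefix block (ℕ.s≤s k≤K)
    ... | ys , eq = run-prefix prefix (subst (λ Π → Run C ⊥ Π X₁) (trans Π-concat eq) output¹)
      (within-antitone prefix≤ w)
      (blocks-cover Y block (suc k) (λ j j<1+k → block-lists j (≤K j<1+k)) k ℕ.≤-refl i∈Y)
      where
      prefix = concat (applyUpTo block (suc k))
      ≤K : ∀ {j} → j ℕ.< suc k → j ℕ.≤ K
      ≤K j<1+k = ℕ.≤-trans (ℕ.s≤s⁻¹ j<1+k) k≤K
      block≤ : ∀ j → j ℕ.< suc k → total s (block j) ℕ.≤ capacity j
      block≤ j j<1+k with block-lists j (≤K j<1+k)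
      ... | unique , lists = ℕ.≤-trans (unique-total-≤ s unique λ {i} → Equivalence.to (lists i))
        (ℕ.≤-trans (weight-mono s {Y j ─ ⋃ (applyUpTo Y j)} {Y j} (p─q⊆p (Y j) _))
          (greedy-size (Y-greedy j (≤K j<1+k)) (ℕ.≤-trans (ℕ.≤-reflexive (weight-⊥ s)) ℕ.z≤n)))
      prefix≤ : size ⊥ ℕ.+ total s prefix ℕ.≤ capacity (suc k)
      prefix≤ = subst (λ w → w ℕ.+ total s prefix ℕ.≤ capacity (suc k)) (sym (weight-⊥ s))
        (ℕ.≤-trans (ℕ.m≤m+n (total s prefix) s-min) (total-doubling s block s-min (suc k) block≤))

    -- Two distinct items weigh at least `s-min + (s-min + 0)`, to which `capacity 1` computes.
    small⇒single : size O ℕ.< capacity 1 → ∀ {i j} → i ∈ O → j ∈ O → i ≡ j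
    small⇒single O< {i} {j} i∈O j∈O with i Fin.≟ j
    ... | yes i≡j = i≡j
    ... | no  i≢j = ⊥-elim (ℕ.<-irrefl refl (ℕ.<-≤-trans O< (ℕ.≤-trans
      (ℕ.+-mono-≤ (minimum-≤ s i) (ℕ.+-monoˡ-≤ 0 (minimum-≤ s j)))
      (unique-total-≤ s ((i≢j ∷ []) ∷ [] ∷ []) λ { (here refl) → i∈O ; (there (here refl)) → j∈O }))))

    -- Descends to the largest k ≤ K such that 2ᵏ⁺¹ s-min fits into C.
    search : ∀ k → k ℕ.≤ K → size O ℕ.≤ 4 ℕ.* capacity k → share ≤ f X₁ + f X₂
    search k k≤K O≤ = ≤-by-cases {Within C (capacity (suc k))} share (f X₁ + f X₂) packed (smaller k k≤K)
      where
      packed : Within C (capacity (suc k)) → share ≤ f X₁ + f X₂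
      packed w = ≤-trans share (f (Y k) + f X₂) (f X₁ + f X₂)
        (Loop.greedy-share (capacity k) O≤ (1/ι (capacity k) {{capacity-nonZero k}})
          (0≤1/ι (capacity k) {{capacity-nonZero k}}) (ι-inverse (capacity k) {{capacity-nonZero k}})
          (Y-greedy k k≤K))
        (nonneg⇒≤ (f (Y k) + f X₂) (f X₁ + f X₂) (mono (Y⊆X₁ k≤K w)) λ n →
          solve 3 (λ x y t → x :- y :=  x :+ t :- (y :+ t)) refl
            (seq (f X₁) n) (seq (f (Y k)) n) (seq (f X₂) n))
      O<capacity : ∀ {k} → ¬ Within C (capacity k) → size O ℕ.< capacity k
      O<capacity ¬w = ℕ.≰⇒> λ le → ¬w (within-antitone le O-within)
      smaller : ∀ k → k ℕ.≤ K → ¬ Within C (capacity (suc k)) → share ≤ f X₁ + f X₂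
      smaller zero    _   ¬w = share≤ (f X₁ + f X₂)
        (nonneg⇒≤ (f O) (f X₁ + f X₂)
          (≤⇒nonneg (f O) (f X₂) (single-item (small⇒single (O<capacity {1} ¬w))) ⊕ f-nonneg X₁)
          (λ n → solve 3 (λ x o t → t :- o :+ x := x :+ t :- o) refl
            (seq (f X₁) n) (seq (f O) n) (seq (f X₂) n)))
      -- Here the factor 4 arises: `O` fits into `C` and `capacity (k + 2)` does not, so `O` is
      -- smaller than `capacity (k + 2) = 4 * capacity k`.
      smaller (suc k) k<K ¬w = search k (ℕ.<⇒≤ k<K)
        (ℕ.≤-trans (ℕ.<⇒≤ (O<capacity {suc (suc k)} ¬w)) (ℕ.≤-reflexive
          (trans (cong (ℕ._* s-min) (sym (ℕ.*-assoc 2 2 (2 ℕ.^ k)))) (ℕ.*-assoc 4 (2 ℕ.^ k) s-min))))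

    robust : robustness * f O ≤ fromℚ ½ * (f X₁ + f X₂)
    robust = nonneg⇒≤ (robustness * f O) (fromℚ ½ * (f X₁ + f X₂))
      (nonneg-scale (ℚ.nonNegative⁻¹ ½) (≤⇒nonneg share (f X₁ + f X₂) (search K ℕ.≤-refl O≤)))
      (λ n → trans
        (solve 5 (λ h a b r o → h :* (a :+ b :- (con 1ℚ :- r) :* o)
            := h :* (a :+ b) :- h :* (con 1ℚ :- r) :* o) refl
          ½ (seq (f X₁) n) (seq (f X₂) n) (seq 1/∜𝑒 n) (seq (f O) n))
        (cong (λ p → ½ ℚ.* (seq (f X₁) n ℚ.+ seq (f X₂) n) ℚ.- p ℚ.* seq (f O) n) (sym (robustness-seq n))))
      where
      -- The search can start at `K`: the ceiling of the logarithm makes all items together weigh at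
      -- most `capacity K`.
      O≤ : size O ℕ.≤ 4 ℕ.* capacity K
      O≤ = ℕ.≤-trans (weight-mono s {O} {⊤} ⊆⊤) (ℕ.≤-trans
        (n/d≤k⇒n≤k*d (size ⊤) s-min (2 ℕ.^ K) {{minimum-nonZero s s>0}} (proj₁ K-ceilLog))
        (ℕ.m≤m+n (capacity K) _))

theorem4 : ∀ {m : ℕ} (s : Fin (suc m) → ℕ) (s>0 : ∀ i → NonZero (s i))
    (f : Subset (suc m) → ℝ) →
    (∀ X → 0ℝ ≤ f X) → f ⊥ ≃ 0ℝ → Monotone f → Submodular f →
    let open Policies s s>0 f in
    (fromℚ (+ 110 / 1000) < robustness) ×
    (∀ (Π¹ Π² : List (Fin (suc m))) → IsΠ¹ Π¹ → IsΠ² Π² →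
    ∀ (C : ℝ) → 0ℝ ≤ C →
    ∀ X₁ X₂ O → Output C Π¹ X₁ → Output C Π² X₂ → IsOPT C O →
    robustness * f O ≤ fromℚ ½ * (f X₁ + f X₂))
theorem4 s s>0 f 0≤f f⊥≃0 f-mono f-submodular =
  0·110<robustness ,
  λ Π¹ Π² isΠ¹ isΠ² C _ X₁ X₂ O output¹ output² opt → robust isΠ¹ isΠ² output¹ output² opt
  where open Analysis s s>0 f 0≤f f⊥≃0 f-mono f-submodular
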